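{- (i) For every fixed positive integer $r$, the number of induced $\vee_r$-free families $\mathcal F\subseteq 2^{[n]}$ is $2^{(1+o(1))\binom{n}{\lfloor n/2\rfloor}}$ as $n\to\infty$. (ii) For every fixed pair of positive integers $s,t$, the number of induced $K_{s,1,t}$-free families $\mathcal F\subseteq 2^{[n]}$ is $2^{(2+o(1))\binom{n}{\lfloor n/2\rfloor}}$ as $n\to\infty$.
   Context: For a finite poset $(P,\le)$ and $\mathcal F\subseteq 2^{[n]}$, an induced copy of $P$ in $\mathcal F$ is a subfamily $\mathcal G\subseteq\mathcal F$ with a bijection $i:P\to\mathcal G$ such that for all $p,q$, $p\le q$ iff $i(p)\subseteq i(q)$; $\mathcal F$ is induced $P$-free if it contains no induced copy of $P$. $\vee_r$ is the poset on elements $a,b_1,\dots,b_r$ with $a<b_j$ for all $j$ and the $b_j$ pairwise incomparable. $K_{s,1,t}$ is the poset on $a_1,\dots,a_s,b,c_1,\dots,c_t$ with $a_j<b<c_k$ for all $j,k$, the $a_j$ pairwise incomparable and the $c_k$ pairwise incomparable. -}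

module Defs where

open import Data.Nat using (ℕ; zero; suc; _+_; _*_; _∸_; _^_; _≤_; _<_; _/_)
open import Data.Nat.Combinatorics using (_C_)
open import Data.Fin using (Fin; toℕ)
open import Data.Fin.Subset using (Subset; inside; outside; _⊆_)
open import Data.Vec using ([]; _∷_)
open import Data.List using (List; []; _∷_; [_]; map; _++_)
open import Data.List.Membership.Propositional using (_∈_)
open import Data.Product using (Σ; _×_)
open import Data.Sum using (_⊎_)
open import Relation.Binary.PropositionalEquality using (_≡_)
open import Relation.Nullary using (¬_)
open import Function.Bundles using (_⇔_)
open import Function.Definitions using (Injective)

record FinPoset : Set₁ where
  field
    size : ℕ
    _≼_  : Fin size → Fin size → Set

graded : (m : ℕ) → (Fin m → ℕ) → FinPoset
graded m lvl = record { size = m ; _≼_ = λ x y → (x ≡ y) ⊎ (lvl x < lvl y) }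

vee : ℕ → FinPoset
vee r = graded (suc r) lvl
  where
  lvl : Fin (suc r) → ℕ
  lvl Fin.zero    = 0
  lvl (Fin.suc _) = 1

-- K_{s,1,t} : elements 0..s-1 are a_j, element s is b, elements s+1..s+t are c_k.
Kst : ℕ → ℕ → FinPoset
Kst s t = graded (s + suc t) lvl
  where
  lvl : Fin (s + suc t) → ℕ
  lvl x with toℕ x Data.Nat.<? s
  ... | Relation.Nullary.yes _ = 0
  ... | Relation.Nullary.no _ with toℕ x Data.Nat.≟ s
  ...   | Relation.Nullary.yes _ = 1
  ...   | Relation.Nullary.no _ = 2

-- A family of subsets of [n] is a duplicate-free list of subsets.
Family : ℕ → Set
Family n = List (Subset n)

InducedCopy : (P : FinPoset) {n : ℕ} → Family n → Set
InducedCopy P {n} F =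
  Σ (Fin size → Subset n) λ i →
    (∀ p → i p ∈ F) × Injective _≡_ _≡_ i × (∀ p q → (p ≼ q) ⇔ (i p ⊆ i q))
  where open FinPoset P

InducedFree : (P : FinPoset) {n : ℕ} → Family n → Set
InducedFree P F = ¬ InducedCopy P F

allSubsets : (n : ℕ) → List (Subset n)
allSubsets zero    = [ [] ]
allSubsets (suc n) = map (outside ∷_) (allSubsets n) ++ map (inside ∷_) (allSubsets n)

sublists : {A : Set} → List A → List (List A)
sublists []       = [ [] ]
sublists (x ∷ xs) = sublists xs ++ map (x ∷_) (sublists xs)

allFamilies : (n : ℕ) → List (Family n)
allFamilies n = sublists (allSubsets n)

data CountSat {A : Set} (P : A → Set) : List A → ℕ → Set where
  nil  : CountSat P [] 0
  hit  : ∀ {x xs c} → P x → CountSat P xs c → CountSat P (x ∷ xs) (suc c)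
  miss : ∀ {x xs c} → ¬ P x → CountSat P xs c → CountSat P (x ∷ xs) c

NumFree : FinPoset → ℕ → ℕ → Set
NumFree P n c = CountSat (λ F → InducedFree P F) (allFamilies n) c

mid : ℕ → ℕ
mid n = n C (n / 2)

-- c = 2^((a + o(1)) mid n): for every k ≥ 1 there is N with, for n ≥ N,
-- (a - 1/k) mid n ≤ log₂ c ≤ (a + 1/k) mid n, i.e.
-- 2^((a k - 1) mid n) ≤ c^k ≤ 2^((a k + 1) mid n).
AsymptoticExp : ℕ → FinPoset → Set
AsymptoticExp a P =
  ∀ k → 1 ≤ k → Σ ℕ λ N → ∀ n → N ≤ n → Σ ℕ λ c →
    NumFree P n c ×
    (2 ^ ((a * k ∸ 1) * mid n) ≤ c ^ k) × (c ^ k ≤ 2 ^ ((a * k + 1) * mid n))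

{-# OPTIONS --safe #-}
-- Containers on the comparability relation, one level at a time. In an induced ∨_r-free family every member
-- has fewer than r members of the family above it on each level. On the other hand, if a collection of sets
-- with at least n/4 missing elements has more than (1 + ε) mid n members, then some member has many (a constant
-- times n) of them above it on one level: otherwise the number of members on a random maximal chain started
-- at a set A has expectation at most 1 + ε, by downward induction on A (if A is not a member, average over the
-- sets covering A). Repeatedly asking whether such a crowded set belongs to the family therefore shrinks the
-- collection quickly, and all ∨_r-free families are described by 2^(o(mid n)) collections of size (1 + ε) mid n;
-- the sets with fewer than n/4 missing elements are negligible by Chebyshev. An induced K_{s,1,t}-free family
-- is the union of a ∨_t-free and a ∧_s-free one, which gives the exponent 2. The lower bounds come from the
-- subfamilies of the middle layer, respectively of two consecutive middle layers.
module Submission where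

open import Defs
open import Algebra.Properties.CommutativeSemigroup using (interchange)
import Data.Bool.Properties as Bool
open import Data.Empty using (⊥)
open import Data.Fin as Fin using (Fin; zero; suc; toℕ; splitAt; _↑ˡ_; _↑ʳ_; inject≤)
import Data.Fin.Properties as Finₚ
open import Data.Fin.Subset using (Subset; inside; outside; _⊆_; ∣_∣; ∁) renaming (⊥ to ∅)
open import Data.Fin.Subset.Properties hiding (_∈?_)
open import Data.List using (List; []; _∷_; map; _++_; length; filter; take; lookup; upTo; applyUpTo; cartesianProductWith)
open import Data.List.Membership.Propositional using (_∈_; _∉_; find; lose)
import Data.List.Membership.DecPropositional as DecMembership
open import Data.List.Membership.Propositional.Properties
open import Data.List.Properties using (length-map; length-++; length-take; length-filter; length-applyUpTo; map-++)
open import Data.List.Relation.Binary.Sublist.Propositional as Sub using ([]; _∷_; _∷ʳ_) renaming (_⊆_ to _⊑_)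
open import Data.List.Relation.Binary.Sublist.Propositional.Properties using (filter-⊆; take-⊆)
open import Data.List.Relation.Binary.Subset.Propositional using () renaming (_⊆_ to _⊆ᴸ_)
open import Data.List.Relation.Unary.All as All using ([]; _∷_)
open import Data.List.Relation.Unary.AllPairs using ([]; _∷_)
open import Data.List.Relation.Unary.Any using (Any; here; there; any?)
open import Data.List.Relation.Unary.Unique.Propositional using (Unique)
import Data.List.Relation.Unary.Unique.Propositional.Properties as Uniqueₚ
open import Data.Nat
open import Data.Nat.Combinatorics using (_C_; nCk≡n!/k![n-k]!; nCk≡nC[n∸k]; nCk+nC[k+1]≡[n+1]C[k+1]; k![n∸k]!∣n!)
open import Data.Nat.DivMod using (m≡m%n+[m/n]*n; m%n<n; m/n*n≡m; m/n*n≤m; m*n/n≡m; /-monoˡ-≤)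
open import Data.Nat.Induction using (Acc; acc; <-wellFounded)
open import Data.Nat.ListAction using (sum)
open import Data.Nat.ListAction.Properties using (sum-++)
open import Data.Nat.Properties
open import Data.Nat.Tactic.RingSolver using (solve-∀)
open import Data.Product using (∃-syntax; _×_; _,_; proj₁; proj₂)
open import Data.Sum using (_⊎_; inj₁; inj₂; [_,_]′)
open import Data.Vec using ([]; _∷_; here; there)
open import Data.Vec.Functional as Vecᶠ using (Vector)
open import Data.Vec.Properties using (≡-dec)
open import Function using (_∘_)
open import Function.Bundles using (_⇔_; mk⇔; Equivalence)
open import Relation.Binary using (DecidableEquality; tri<; tri≈; tri>)
open import Relation.Binary.PropositionalEquality hiding ([_])
open import Relation.Nullary using (¬_; Dec; yes; no)
open import Relation.Nullary.Decidable using (¬?; _×-dec_; _⊎-dec_; _→-dec_; map′)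
open import Relation.Nullary.Negation using (contradiction)
open import Relation.Unary using (Decidable)

-- Why single levels suffice: if A misses p + 2 elements, a set above it at distance g lies on g! (p
-- + 2 - g)! of the (p + 2)! maximal chains from A. That is (p + 1)! for g = 1 and at most 2 p! for
-- g ≥ 2, provided the upper set still misses two elements. So δ sets on every level meet at most 3
-- δ (p + 1)! chains, a share of order δ / n. Two scales confine δ. For this share to be negligible,
-- δ must be small compared with n. On the other side, each crowded set taken into the family
-- removes δ sets at a price of O(log n) bits, in total about 2^n log n / δ bits. As mid n has order
-- 2^n / √n, this is o(mid n) only if δ is large compared with √n log n. The choice below is n^(3/4)
-- times a logarithm. All estimates stay in ℕ: probabilities are multiplied by factorials, square
-- roots are squared, and powers of 1 + 1/q are split into powers of q + 1 and of q.

private variable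
  m n : ℕ
  X Y Z : Set

-- Finite sums, counting and sublists

infix 10 ∑
∑ : List X → (X → ℕ) → ℕ
∑ xs f = sum (map f xs)
syntax ∑ xs (λ x → e) = ∑[ x ← xs ] e

∑-mono-≤ : ∀ (xs : List X) {f g} → (∀ {x} → x ∈ xs → f x ≤ g x) → ∑ xs f ≤ ∑ xs g
∑-mono-≤ []       f≤g = z≤n
∑-mono-≤ (x ∷ xs) f≤g = +-mono-≤ (f≤g (here refl)) (∑-mono-≤ xs (f≤g ∘ there))

∑-cong : ∀ (xs : List X) {f g} → (∀ {x} → x ∈ xs → f x ≡ g x) → ∑ xs f ≡ ∑ xs g
∑-cong []       f≡g = refl
∑-cong (x ∷ xs) f≡g = cong₂ _+_ (f≡g (here refl)) (∑-cong xs (f≡g ∘ there))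

∑-distrib-+ : ∀ (xs : List X) f g → ∑[ x ← xs ] (f x + g x) ≡ ∑ xs f + ∑ xs g
∑-distrib-+ []       f g = refl
∑-distrib-+ (x ∷ xs) f g rewrite ∑-distrib-+ xs f g =
  interchange +-commutativeSemigroup (f x) (g x) (∑ xs f) (∑ xs g)

∑-*ˡ : ∀ c (xs : List X) f → ∑[ x ← xs ] (c * f x) ≡ c * ∑ xs f
∑-*ˡ c []       f = sym (*-zeroʳ c)
∑-*ˡ c (x ∷ xs) f rewrite ∑-*ˡ c xs f = sym (*-distribˡ-+ c (f x) (∑ xs f))

∑-const : ∀ c (xs : List X) → ∑[ _ ← xs ] c ≡ length xs * c
∑-const c []       = refl
∑-const c (x ∷ xs) = cong (c +_) (∑-const c xs)

∑-comm : ∀ (xs : List X) (ys : List Y) (f : X → Y → ℕ) →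
         ∑[ x ← xs ] ∑[ y ← ys ] f x y ≡ ∑[ y ← ys ] ∑[ x ← xs ] f x y
∑-comm []       ys f = sym (trans (∑-const 0 ys) (*-zeroʳ (length ys)))
∑-comm (x ∷ xs) ys f rewrite ∑-comm xs ys f =
  sym (∑-distrib-+ ys (f x) (λ y → ∑[ x′ ← xs ] f x′ y))

∑-++ : ∀ (xs ys : List X) f → ∑ (xs ++ ys) f ≡ ∑ xs f + ∑ ys f
∑-++ xs ys f rewrite map-++ f xs ys = sum-++ (map f xs) (map f ys)

∑-map : ∀ (h : X → Y) xs f → ∑ (map h xs) f ≡ ∑ xs (f ∘ h)
∑-map h []       f = refl
∑-map h (x ∷ xs) f = cong (f (h x) +_) (∑-map h xs f)

term≤∑ : ∀ {xs : List X} {x} f → x ∈ xs → f x ≤ ∑ xs f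
term≤∑ f (here refl) = m≤m+n _ _
term≤∑ {xs = y ∷ _} f (there x∈xs) = ≤-trans (term≤∑ f x∈xs) (m≤n+m _ (f y))

length-⊆ : ∀ {xs ys : List X} → Unique xs → xs ⊆ᴸ ys → length xs ≤ length ys
length-⊆ {xs = []} _ _ = z≤n
length-⊆ {xs = x ∷ xs} (x∉xs ∷ u) xs⊆ys with ∈-∃++ (xs⊆ys (here refl))
... | us , vs , refl = begin
  suc (length xs)               ≤⟨ s≤s (length-⊆ u λ y∈xs → drop-x (xs⊆ys (there y∈xs)) λ { refl → All.lookup x∉xs y∈xs refl }) ⟩
  suc (length (us ++ vs))       ≡⟨ cong suc (length-++ us) ⟩
  suc (length us + length vs)   ≡⟨ +-suc (length us) (length vs) ⟨
  length us + length (x ∷ vs)   ≡⟨ length-++ us ⟨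
  length (us ++ x ∷ vs)         ∎
  where
  open ≤-Reasoning
  drop-x : ∀ {y} → y ∈ us ++ x ∷ vs → y ≢ x → y ∈ us ++ vs
  drop-x y∈ y≢x with ∈-++⁻ us y∈
  ... | inj₁ y∈us         = ∈-++⁺ˡ y∈us
  ... | inj₂ (here y≡x)   = contradiction y≡x y≢x
  ... | inj₂ (there y∈vs) = ∈-++⁺ʳ us y∈vs

module _ {P : X → Set} where

  private variable
    xs : List X
    c : ℕ

  countSat : (∀ x → Dec (P x)) → ∀ xs → ∃[ c ] CountSat P xs c
  countSat P? [] = 0 , nil
  countSat P? (x ∷ xs) with P? x | countSat P? xs
  ... | yes px | c , cs = suc c , hit px cs
  ... | no ¬px | c , cs = c , miss ¬px cs

  -- `CountSat` records only a number; recovering the list of hits turns upper and lower bounds on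
  -- it into instances of `length-⊆`.
  satisfying : CountSat P xs c → List X
  satisfying nil                = []
  satisfying (hit {x = x} px cs) = x ∷ satisfying cs
  satisfying (miss ¬px cs)       = satisfying cs

  length-satisfying : (cs : CountSat P xs c) → length (satisfying cs) ≡ c
  length-satisfying nil          = refl
  length-satisfying (hit px cs)   = cong suc (length-satisfying cs)
  length-satisfying (miss ¬px cs) = length-satisfying cs

  ∈-satisfying⁻ : ∀ {y} (cs : CountSat P xs c) → y ∈ satisfying cs → y ∈ xs × P y
  ∈-satisfying⁻ (hit px cs) (here refl) = here refl , px
  ∈-satisfying⁻ (hit px cs) (there y∈) with ∈-satisfying⁻ cs y∈
  ... | y∈xs , py = there y∈xs , py
  ∈-satisfying⁻ (miss ¬px cs) y∈ with ∈-satisfying⁻ cs y∈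
  ... | y∈xs , py = there y∈xs , py

  ∈-satisfying⁺ : ∀ {y} (cs : CountSat P xs c) → y ∈ xs → P y → y ∈ satisfying cs
  ∈-satisfying⁺ (hit px cs)   (here refl) py = here refl
  ∈-satisfying⁺ (hit px cs)   (there y∈)  py = there (∈-satisfying⁺ cs y∈ py)
  ∈-satisfying⁺ (miss ¬px cs) (here refl) py = contradiction py ¬px
  ∈-satisfying⁺ (miss ¬px cs) (there y∈)  py = ∈-satisfying⁺ cs y∈ py

  satisfying-unique : (cs : CountSat P xs c) → Unique xs → Unique (satisfying cs)
  satisfying-unique nil          u         = []
  satisfying-unique (hit px cs)   (x∉ ∷ u) =
    All.tabulate (λ y∈ → All.lookup x∉ (proj₁ (∈-satisfying⁻ cs y∈))) ∷ satisfying-unique cs u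
  satisfying-unique (miss ¬px cs) (x∉ ∷ u) = satisfying-unique cs u

  count-≤ : CountSat P xs c → Unique xs → ∀ ys → (∀ {x} → x ∈ xs → P x → x ∈ ys) → c ≤ length ys
  count-≤ cs u ys cov = subst (_≤ length ys) (length-satisfying cs)
    (length-⊆ (satisfying-unique cs u) λ x∈ → let (x∈xs , px) = ∈-satisfying⁻ cs x∈ in cov x∈xs px)

  count-≥ : CountSat P xs c → ∀ {ys} → Unique ys → (∀ {y} → y ∈ ys → y ∈ xs × P y) → length ys ≤ c
  count-≥ cs {ys} u sat = subst (length ys ≤_) (length-satisfying cs)
    (length-⊆ u λ y∈ → let (y∈xs , py) = sat y∈ in ∈-satisfying⁺ cs y∈xs py)

length-sublists : ∀ (xs : List X) → length (sublists xs) ≡ 2 ^ length xs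
length-sublists []       = refl
length-sublists (x ∷ xs) = begin
  length (sublists xs ++ map (x ∷_) (sublists xs))          ≡⟨ length-++ (sublists xs) ⟩
  length (sublists xs) + length (map (x ∷_) (sublists xs))  ≡⟨ cong (length (sublists xs) +_) (length-map (x ∷_) (sublists xs)) ⟩
  length (sublists xs) + length (sublists xs)               ≡⟨ cong (λ l → l + l) (length-sublists xs) ⟩
  2 ^ length xs + 2 ^ length xs                             ≡⟨ cong (2 ^ length xs +_) (+-identityʳ _) ⟨
  2 ^ length (x ∷ xs)                                       ∎
  where open ≡-Reasoning

∈-sublists⁻ : ∀ xs {ys : List X} → ys ∈ sublists xs → ys ⊑ xs
∈-sublists⁻ []       (here refl) = []
∈-sublists⁻ (x ∷ xs) ys∈ with ∈-++⁻ (sublists xs) ys∈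
... | inj₁ p = x ∷ʳ ∈-sublists⁻ xs p
... | inj₂ p with ∈-map⁻ (x ∷_) p
...   | _ , q , refl = refl ∷ ∈-sublists⁻ xs q

∈-sublists⁺ : ∀ {xs ys : List X} → ys ⊑ xs → ys ∈ sublists xs
∈-sublists⁺ []         = here refl
∈-sublists⁺ (x ∷ʳ p)   = ∈-++⁺ˡ (∈-sublists⁺ p)
∈-sublists⁺ {xs = x ∷ xs} (refl ∷ p) = ∈-++⁺ʳ (sublists xs) (∈-map⁺ (x ∷_) (∈-sublists⁺ p))

⊑-unique : ∀ {xs ys : List X} → ys ⊑ xs → Unique xs → Unique ys
⊑-unique []         _        = []
⊑-unique (x ∷ʳ p)   (_ ∷ u)  = ⊑-unique p u
⊑-unique (refl ∷ p) (x∉ ∷ u) = All.tabulate (λ z∈ → All.lookup x∉ (Sub.lookup p z∈)) ∷ ⊑-unique p u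

sublists-unique : ∀ {xs : List X} → Unique xs → Unique (sublists xs)
sublists-unique {xs = []} u = [] ∷ []
sublists-unique {xs = x ∷ xs} (x∉ ∷ u) =
  Uniqueₚ.++⁺ (sublists-unique u) (Uniqueₚ.map⁺ (λ { refl → refl }) (sublists-unique u)) disjoint
  where
  disjoint : ∀ {ys} → ys ∈ sublists xs × ys ∈ map (x ∷_) (sublists xs) → ⊥
  disjoint (p , q) with ∈-map⁻ (x ∷_) q
  ... | _ , _ , refl = All.lookup x∉ (Sub.lookup (∈-sublists⁻ xs p) (here refl)) refl

-- Sublists inherit the order of `xs`, so membership determines them. `num-free-≤` uses this to pass
-- from equal members to equal lists.
⊑-ext : ∀ {xs ys zs : List X} → Unique xs → ys ⊑ xs → zs ⊑ xs → ys ⊆ᴸ zs → zs ⊆ᴸ ys → ys ≡ zs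
⊑-ext _ [] [] _ _ = refl
⊑-ext (x∉ ∷ u) (x ∷ʳ p) (.x ∷ʳ q) ⊆₁ ⊆₂ = ⊑-ext u p q ⊆₁ ⊆₂
⊑-ext (x∉ ∷ u) (x ∷ʳ p) (refl ∷ q) ⊆₁ ⊆₂ =
  contradiction refl (All.lookup x∉ (Sub.lookup p (⊆₂ (here refl))))
⊑-ext (x∉ ∷ u) (refl ∷ p) (x ∷ʳ q) ⊆₁ ⊆₂ =
  contradiction refl (All.lookup x∉ (Sub.lookup q (⊆₁ (here refl))))
⊑-ext {xs = x ∷ xs} (x∉ ∷ u) (refl ∷ p) (refl ∷ q) ⊆₁ ⊆₂ =
  cong (x ∷_) (⊑-ext u p q (λ z∈ → tail p z∈ (⊆₁ (there z∈))) (λ z∈ → tail q z∈ (⊆₂ (there z∈))))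
  where
  tail : ∀ {ys ws z} → ys ⊑ xs → z ∈ ys → z ∈ x ∷ ws → z ∈ ws
  tail r z∈ (here refl) = contradiction refl (All.lookup x∉ (Sub.lookup r z∈))
  tail r z∈ (there z∈′) = z∈′

length-cartesianProductWith : ∀ (f : X → Y → Z) xs ys →
                              length (cartesianProductWith f xs ys) ≡ length xs * length ys
length-cartesianProductWith f []       ys = refl
length-cartesianProductWith f (x ∷ xs) ys = trans (length-++ (map (f x) ys))
  (cong₂ _+_ (length-map (f x) ys) (length-cartesianProductWith f xs ys))

-- Binomial coefficients

C*!*! : ∀ a b → ((a + b) C a) * (a ! * b !) ≡ (a + b) !
C*!*! a b = begin
  ((a + b) C a) * (a ! * b !)          ≡⟨ cong (λ c → ((a + b) C a) * (a ! * c !)) (m+n∸m≡n a b) ⟨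
  ((a + b) C a) * (a ! * (a + b ∸ a) !)  ≡⟨ cong (_* (a ! * (a + b ∸ a) !)) (nCk≡n!/k![n-k]! a≤a+b) ⟩
  ((a + b) ! / (a ! * (a + b ∸ a) !)) {{a !* (a + b ∸ a) !≢0}} * (a ! * (a + b ∸ a) !)
    ≡⟨ m/n*n≡m {{a !* (a + b ∸ a) !≢0}} (k![n∸k]!∣n! a≤a+b) ⟩
  (a + b) !                            ∎
  where
  open ≡-Reasoning
  a≤a+b = m≤m+n a b

-- Multiplied by `a ! * b !`, both sides become `(a + suc b) !`. Additive indices avoid truncated
-- subtraction.
C-step : ∀ a b → ((a + suc b) C suc a) * suc a ≡ ((a + suc b) C a) * suc b
C-step a b = *-cancelʳ-≡ _ _ (a ! * b !) {{a !* b !≢0}} (begin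
  (N C suc a) * suc a * (a ! * b !)    ≡⟨ r₁ (N C suc a) (suc a) (a !) (b !) ⟩
  (N C suc a) * (suc a ! * b !)        ≡⟨ cong (λ k → (k C suc a) * (suc a ! * b !)) (+-suc a b) ⟩
  ((suc a + b) C suc a) * (suc a ! * b !)  ≡⟨ C*!*! (suc a) b ⟩
  (suc a + b) !                        ≡⟨ cong _! (+-suc a b) ⟨
  N !                                  ≡⟨ C*!*! a (suc b) ⟨
  (N C a) * (a ! * suc b !)            ≡⟨ r₂ (N C a) (a !) (suc b) (b !) ⟩
  (N C a) * suc b * (a ! * b !)        ∎)
  where
  open ≡-Reasoning
  N = a + suc b
  r₁ : ∀ x s p q → x * s * (p * q) ≡ x * (s * p * q)
  r₁ = solve-∀
  r₂ : ∀ x p s q → x * (p * (s * q)) ≡ x * s * (p * q)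
  r₂ = solve-∀

C-absorb : ∀ a b → ((suc a + b) C suc a) * suc a ≡ ((a + b) C a) * suc (a + b)
C-absorb a b = *-cancelʳ-≡ _ _ (a ! * b !) {{a !* b !≢0}} (begin
  ((suc a + b) C suc a) * suc a * (a ! * b !)  ≡⟨ r₁ ((suc a + b) C suc a) (suc a) (a !) (b !) ⟩
  ((suc a + b) C suc a) * (suc a ! * b !)      ≡⟨ C*!*! (suc a) b ⟩
  suc (a + b) * (a + b) !                      ≡⟨ cong (suc (a + b) *_) (C*!*! a b) ⟨
  suc (a + b) * (((a + b) C a) * (a ! * b !))  ≡⟨ r₂ (suc (a + b)) ((a + b) C a) (a ! * b !) ⟩
  ((a + b) C a) * suc (a + b) * (a ! * b !)    ∎)
  where
  open ≡-Reasoning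
  r₁ : ∀ x s p q → x * s * (p * q) ≡ x * (s * p * q)
  r₁ = solve-∀
  r₂ : ∀ s x p → s * (x * p) ≡ x * s * p
  r₂ = solve-∀

half : ∀ n → n ≡ n / 2 + n / 2 ⊎ n ≡ suc (n / 2 + n / 2)
half n with n % 2 | m%n<n n 2 | m≡m%n+[m/n]*n n 2
... | 0 | _ | eq = inj₁ (trans eq (r (n / 2)))
  where
  r : ∀ h → h * 2 ≡ h + h
  r = solve-∀
... | 1 | _ | eq = inj₂ (trans eq (cong suc (r (n / 2))))
  where
  r : ∀ h → h * 2 ≡ h + h
  r = solve-∀
... | suc (suc _) | s≤s (s≤s ()) | _

n/2+n/2≤n : ∀ n → n / 2 + n / 2 ≤ n
n/2+n/2≤n n with half n
... | inj₁ eq = ≤-reflexive (sym eq)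
... | inj₂ eq = ≤-trans (n≤1+n _) (≤-reflexive (sym eq))

n≤1+n/2+n/2 : ∀ n → n ≤ suc (n / 2 + n / 2)
n≤1+n/2+n/2 n with half n
... | inj₁ eq = ≤-trans (≤-reflexive eq) (n≤1+n _)
... | inj₂ eq = ≤-reflexive eq

C-incr : ∀ {n k} → k < n / 2 → n C k ≤ n C suc k
C-incr {n} {k} k<h = *-cancelʳ-≤ (n C k) (n C suc k) (suc k) (begin
  (n C k) * suc k       ≤⟨ *-monoʳ-≤ (n C k) (s≤s k≤j) ⟩
  (n C k) * suc j       ≡⟨ cong (λ m → (m C k) * suc j) n≡ ⟩
  ((k + suc j) C k) * suc j  ≡⟨ C-step k j ⟨
  ((k + suc j) C suc k) * suc k ≡⟨ cong (λ m → (m C suc k) * suc k) n≡ ⟨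
  (n C suc k) * suc k   ∎)
  where
  open ≤-Reasoning
  j = n ∸ suc k
  2k+2≤n : suc k + suc k ≤ n
  2k+2≤n = ≤-trans (+-mono-≤ k<h k<h) (n/2+n/2≤n n)
  n≡ : n ≡ k + suc j
  n≡ = trans (sym (m+[n∸m]≡n (m+n≤o⇒m≤o (suc k) 2k+2≤n))) (sym (+-suc k j))
  k≤j : k ≤ j
  k≤j = ≤-trans (n≤1+n k) (m+n≤o⇒m≤o∸n (suc k) 2k+2≤n)

C-≤-mid-low : ∀ {n} k → k ≤ n / 2 → n C k ≤ mid n
C-≤-mid-low {n} k k≤h = go (n / 2 ∸ k) k (m+[n∸m]≡n k≤h)
  where
  go : ∀ d k → k + d ≡ n / 2 → n C k ≤ mid n
  go zero    k eq = ≤-reflexive (cong (n C_) (trans (sym (+-identityʳ k)) eq))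
  go (suc d) k eq = ≤-trans
    (C-incr (subst (k <_) eq (subst (suc k ≤_) (sym (+-suc k d)) (s≤s (m≤m+n k d)))))
    (go d (suc k) (trans (sym (+-suc k d)) eq))

C-≤-mid : ∀ {n k} → k ≤ n → n C k ≤ mid n
C-≤-mid {n} {k} k≤n with k ≤? n / 2
... | yes k≤h = C-≤-mid-low k k≤h
... | no  k≰h = subst (_≤ mid n) (sym (nCk≡nC[n∸k] k≤n)) (C-≤-mid-low (n ∸ k) (begin
  n ∸ k                        ≤⟨ ∸-mono (n≤1+n/2+n/2 n) (≰⇒> k≰h) ⟩
  suc (n / 2 + n / 2) ∸ suc (n / 2)  ≡⟨ m+n∸m≡n (n / 2) (n / 2) ⟩
  n / 2                        ∎))
  where open ≤-Reasoning

!≤mid*!*! : ∀ a b → (a + b) ! ≤ mid (a + b) * (a ! * b !)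
!≤mid*!*! a b = subst (_≤ mid (a + b) * (a ! * b !)) (C*!*! a b)
  (*-monoˡ-≤ (a ! * b !) (C-≤-mid (m≤m+n a b)))

central-even : ∀ m → ((suc m + suc m) C suc m) ≡ 2 * ((suc m + m) C m)
central-even m = begin
  ((suc m + suc m) C suc m)              ≡⟨ nCk+nC[k+1]≡[n+1]C[k+1] (m + suc m) m ⟨
  ((m + suc m) C m) + ((m + suc m) C suc m)  ≡⟨ cong₂ (λ x y → (x C m) + y) (+-suc m m) sym′ ⟩
  ((suc m + m) C m) + ((suc m + m) C m)  ≡⟨ cong (((suc m + m) C m) +_) (+-identityʳ _) ⟨
  2 * ((suc m + m) C m)                  ∎
  where
  open ≡-Reasoning
  sym′ : (m + suc m) C suc m ≡ (suc m + m) C m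
  sym′ = trans (nCk≡nC[n∸k] (m≤n+m (suc m) m))
    (cong₂ _C_ (+-suc m m) (m+n∸n≡m m (suc m)))

central-odd : ∀ m → ((suc m + m) C m) * suc m ≡ ((m + m) C m) * suc (m + m)
central-odd m = trans (cong (_* suc m) (trans (nCk≡nC[n∸k] (m≤n+m m (suc m))) (cong ((suc m + m) C_) (m+n∸n≡m (suc m) m))))
  (C-absorb m m)

-- With M = m + 1 this is C(2M, M) ≥ 4^M / (2 √M), squared. Since C(2M+2, M+1) = C(2M, M) · 2 (2M+1)
-- / (M+1), the induction step comes down to 4 M (M+1) ≤ (2M+1)².
16^≤central² : ∀ m → 16 ^ suc m ≤ 4 * suc m * (((suc m + suc m) C suc m) * ((suc m + suc m) C suc m))
16^≤central² zero = ≤-refl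
16^≤central² (suc m) = *-cancelʳ-≤ _ _ (M * suc M) (begin
  16 * 16 ^ M * (M * suc M)   ≤⟨ *-monoˡ-≤ (M * suc M) (*-monoʳ-≤ 16 (16^≤central² m)) ⟩
  16 * (4 * M * (c * c)) * (M * suc M)   ≡⟨ r₁ m c ⟩
  16 * M * (c * c) * (4 * (M * suc M))   ≤⟨ *-monoʳ-≤ (16 * M * (c * c)) 4M[M+1]≤ ⟩
  16 * M * (c * c) * (suc (M + M) * suc (M + M))   ≡⟨ r₂ M c (suc (M + M)) ⟩
  16 * M * ((c * suc (M + M)) * (c * suc (M + M)))   ≡⟨ cong (λ x → 16 * M * (x * x)) (central-odd M) ⟨
  16 * M * ((o * suc M) * (o * suc M))   ≡⟨ r₃ M o (suc M) ⟩
  4 * suc M * (2 * o * (2 * o)) * (M * suc M) ≡⟨ cong (λ x → 4 * suc M * (x * x) * (M * suc M)) (central-even M) ⟨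
  4 * suc M * (c′ * c′) * (M * suc M)   ∎)
  where
  open ≤-Reasoning
  M = suc m
  c = (M + M) C M
  c′ = (suc M + suc M) C suc M
  o = (suc M + M) C M
  r₁ : ∀ m c → 16 * (4 * suc m * (c * c)) * (suc m * suc (suc m)) ≡ 16 * suc m * (c * c) * (4 * (suc m * suc (suc m)))
  r₁ = solve-∀
  r₂ : ∀ M c s → 16 * M * (c * c) * (s * s) ≡ 16 * M * ((c * s) * (c * s))
  r₂ = solve-∀
  r₃ : ∀ M o s → 16 * M * ((o * s) * (o * s)) ≡ 4 * s * (2 * o * (2 * o)) * (M * s)
  r₃ = solve-∀
  4M[M+1]≤ : 4 * (M * suc M) ≤ suc (M + M) * suc (M + M)
  4M[M+1]≤ = ≤-trans (n≤1+n _) (≤-reflexive (r₄ M))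
    where
    r₄ : ∀ M → suc (4 * (M * suc M)) ≡ suc (M + M) * suc (M + M)
    r₄ = solve-∀

2^-square : ∀ m → 2 ^ (m + m) * 2 ^ (m + m) ≡ 16 ^ m
2^-square m = begin
  2 ^ (m + m) * 2 ^ (m + m)    ≡⟨ ^-distribˡ-+-* 2 (m + m) (m + m) ⟨
  2 ^ (m + m + (m + m))        ≡⟨ cong (2 ^_) (r m) ⟩
  2 ^ (4 * m)                  ≡⟨ ^-*-assoc 2 4 m ⟨
  16 ^ m                       ∎
  where
  open ≡-Reasoning
  r : ∀ m → m + m + (m + m) ≡ 4 * m
  r = solve-∀

-- An odd n = 2m + 1 inherits the bound from 2m + 2 through C(2m+2, m+1) = 2 C(2m+1, m). Unsquared:
-- mid n ≥ 2^n / (2 √(n+1)).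
4^≤mid² : ∀ n → 2 ^ n * 2 ^ n ≤ 4 * suc n * (mid n * mid n)
4^≤mid² n with half n
... | inj₁ eq = subst (λ N → 2 ^ N * 2 ^ N ≤ 4 * suc N * ((N C (n / 2)) * (N C (n / 2)))) (sym eq) (even (n / 2))
  where
  even : ∀ m → 2 ^ (m + m) * 2 ^ (m + m) ≤ 4 * suc (m + m) * (((m + m) C m) * ((m + m) C m))
  even zero    = s≤s z≤n
  even (suc m) = begin
    2 ^ (M + M) * 2 ^ (M + M)  ≡⟨ 2^-square M ⟩
    16 ^ M                     ≤⟨ 16^≤central² m ⟩
    4 * M * (((M + M) C M) * ((M + M) C M))  ≤⟨ *-monoˡ-≤ (((M + M) C M) * ((M + M) C M)) (*-monoʳ-≤ 4 (≤-trans (m≤m+n M M) (n≤1+n _))) ⟩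
    4 * suc (M + M) * (((M + M) C M) * ((M + M) C M))   ∎
    where
    open ≤-Reasoning
    M = suc m
... | inj₂ eq = subst (λ N → 2 ^ N * 2 ^ N ≤ 4 * suc N * ((N C (n / 2)) * (N C (n / 2)))) (sym eq) (odd (n / 2))
  where
  odd : ∀ m → 2 ^ suc (m + m) * 2 ^ suc (m + m) ≤ 4 * suc (suc (m + m)) * (((suc m + m) C m) * ((suc m + m) C m))
  odd m = *-cancelˡ-≤ 4 (begin
    4 * (2 ^ suc (m + m) * 2 ^ suc (m + m))  ≡⟨ r₁ (2 ^ suc (m + m)) ⟩
    2 ^ suc (suc (m + m)) * 2 ^ suc (suc (m + m))  ≡⟨ cong (λ x → 2 ^ suc x * 2 ^ suc x) (+-suc m m) ⟨
    2 ^ (suc m + suc m) * 2 ^ (suc m + suc m)   ≡⟨ 2^-square (suc m) ⟩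
    16 ^ suc m                                  ≤⟨ 16^≤central² m ⟩
    4 * suc m * (((suc m + suc m) C suc m) * ((suc m + suc m) C suc m))  ≡⟨ cong (λ x → 4 * suc m * (x * x)) (central-even m) ⟩
    4 * suc m * (2 * o * (2 * o))               ≤⟨ m≤m+n (4 * suc m * (2 * o * (2 * o))) (4 * suc m * (2 * o * (2 * o))) ⟩
    4 * suc m * (2 * o * (2 * o)) + 4 * suc m * (2 * o * (2 * o)) ≡⟨ r₂ m o ⟩
    4 * (4 * suc (suc (m + m)) * (o * o)) ∎)
    where
    open ≤-Reasoning
    o = (suc m + m) C m
    r₁ : ∀ x → 4 * (x * x) ≡ 2 * x * (2 * x)
    r₁ = solve-∀
    r₂ : ∀ m o → 4 * suc m * (2 * o * (2 * o)) + 4 * suc m * (2 * o * (2 * o)) ≡ 4 * (4 * suc (suc (m + m)) * (o * o))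
    r₂ = solve-∀

-- For a fixed sum of the arguments, a product of factorials is largest when they are as unequal as
-- possible; with both at least 2, the extreme case is 2 ! times the rest.
!*!-bound : ∀ j k → (2 + j) ! * (2 + k) ! ≤ 2 * (2 + j + k) !
!*!-bound zero    k = ≤-refl
!*!-bound (suc j) k = begin
  (3 + j) * (2 + j) ! * (2 + k) !    ≡⟨ *-assoc (3 + j) ((2 + j) !) ((2 + k) !) ⟩
  (3 + j) * ((2 + j) ! * (2 + k) !)  ≤⟨ *-mono-≤ (m≤m+n (3 + j) k) (!*!-bound j k) ⟩
  (3 + j + k) * (2 * (2 + j + k) !)  ≡⟨ r (3 + j + k) ((2 + j + k) !) ⟩
  2 * (3 + j + k) !                  ∎
  where
  open ≤-Reasoning
  r : ∀ a b → a * (2 * b) ≡ 2 * (a * b)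
  r = solve-∀

-- Supersaturation by counting maximal chains

_≟ˢ_ : DecidableEquality (Subset n)
_≟ˢ_ = ≡-dec Bool._≟_

_∈ᴸ?_ : (A : Subset n) (𝓒 : List (Subset n)) → Dec (A ∈ 𝓒)
_∈ᴸ?_ = DecMembership._∈?_ _≟ˢ_

∣p∣+∣∁p∣≡n : ∀ (p : Subset n) → ∣ p ∣ + ∣ ∁ p ∣ ≡ n
∣p∣+∣∁p∣≡n p = trans (cong (∣ p ∣ +_) (∣∁p∣≡n∸∣p∣ p)) (m+[n∸m]≡n (∣p∣≤n p))

covers : Subset n → List (Subset n)
covers []            = []
covers (inside ∷ A)  = map (inside ∷_) (covers A)
covers (outside ∷ A) = (inside ∷ A) ∷ map (outside ∷_) (covers A)

length-covers : (A : Subset n) → length (covers A) ≡ ∣ ∁ A ∣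
length-covers []            = refl
length-covers (inside ∷ A)  = trans (length-map _ (covers A)) (length-covers A)
length-covers (outside ∷ A) = cong suc (trans (length-map _ (covers A)) (length-covers A))

covers-size : ∀ (A : Subset n) {A′} → A′ ∈ covers A → ∣ A′ ∣ ≡ suc ∣ A ∣
covers-size (inside ∷ A) A′∈ with ∈-map⁻ (inside ∷_) A′∈
... | _ , p , refl = cong suc (covers-size A p)
covers-size (outside ∷ A) (here refl) = refl
covers-size (outside ∷ A) (there A′∈) with ∈-map⁻ (outside ∷_) A′∈
... | _ , p , refl = covers-size A p

covers-cosize : ∀ (A : Subset n) {A′} → A′ ∈ covers A → suc ∣ ∁ A′ ∣ ≡ ∣ ∁ A ∣
covers-cosize A {A′} A′∈ = +-cancelˡ-≡ ∣ A ∣ _ _ (begin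
  ∣ A ∣ + suc ∣ ∁ A′ ∣   ≡⟨ +-suc ∣ A ∣ ∣ ∁ A′ ∣ ⟩
  suc ∣ A ∣ + ∣ ∁ A′ ∣   ≡⟨ cong (_+ ∣ ∁ A′ ∣) (covers-size A A′∈) ⟨
  ∣ A′ ∣ + ∣ ∁ A′ ∣      ≡⟨ ∣p∣+∣∁p∣≡n A′ ⟩
  _                      ≡⟨ ∣p∣+∣∁p∣≡n A ⟨
  ∣ A ∣ + ∣ ∁ A ∣        ∎)
  where open ≡-Reasoning

-- A 0/1 indicator by recursion on the coordinates, so that sums over `covers` can be evaluated
-- coordinate by coordinate.
[_⊆_] : Subset n → Subset n → ℕ
[ []           ⊆ []           ] = 1
[ inside  ∷ A  ⊆ inside  ∷ B  ] = [ A ⊆ B ]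
[ inside  ∷ A  ⊆ outside ∷ B  ] = 0
[ outside ∷ A  ⊆ _ ∷ B        ] = [ A ⊆ B ]

[⊆]-view : (A B : Subset n) → [ A ⊆ B ] ≡ 0 ⊎ [ A ⊆ B ] ≡ 1 × A ⊆ B
[⊆]-view []            []            = inj₂ (refl , λ ())
[⊆]-view (inside  ∷ A) (inside  ∷ B) with [⊆]-view A B
... | inj₁ e = inj₁ e
... | inj₂ (e , p) = inj₂ (e , in⊆in p)
[⊆]-view (inside  ∷ A) (outside ∷ B) = inj₁ refl
[⊆]-view (outside ∷ A) (b       ∷ B) with [⊆]-view A B
... | inj₁ e = inj₁ e
... | inj₂ (e , p) = inj₂ (e , out⊆ p)

[⊆]-refl : (A : Subset n) → [ A ⊆ A ] ≡ 1
[⊆]-refl []            = refl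
[⊆]-refl (inside  ∷ A) = [⊆]-refl A
[⊆]-refl (outside ∷ A) = [⊆]-refl A

[∅⊆] : (A : Subset n) → [ ∅ ⊆ A ] ≡ 1
[∅⊆] []      = refl
[∅⊆] (_ ∷ A) = [∅⊆] A

⊆∧∣∣≡⇒≡ : {A B : Subset n} → A ⊆ B → ∣ A ∣ ≡ ∣ B ∣ → A ≡ B
⊆∧∣∣≡⇒≡ {A = []}          {[]}          _   _ = refl
⊆∧∣∣≡⇒≡ {A = inside ∷ A}  {inside ∷ B}  A⊆B e = cong (inside ∷_) (⊆∧∣∣≡⇒≡ (drop-∷-⊆ A⊆B) (suc-injective e))
⊆∧∣∣≡⇒≡ {A = inside ∷ A}  {outside ∷ B} A⊆B e with A⊆B here
... | ()
⊆∧∣∣≡⇒≡ {A = outside ∷ A} {inside ∷ B}  A⊆B e =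
  contradiction (≤-trans (≤-reflexive (sym e)) (p⊆q⇒∣p∣≤∣q∣ (drop-∷-⊆ A⊆B))) (<⇒≱ ≤-refl)
⊆∧∣∣≡⇒≡ {A = outside ∷ A} {outside ∷ B} A⊆B e = cong (outside ∷_) (⊆∧∣∣≡⇒≡ (drop-∷-⊆ A⊆B) e)

-- For A ⊆ B, the cover A ∪ {i} stays inside B exactly for the ∣B∣ - ∣A∣ elements i of B outside A.
∑-covers-[⊆] : ∀ (A B : Subset n) c → ∑[ A′ ← covers A ] ([ A′ ⊆ B ] * c) ≡ [ A ⊆ B ] * ((∣ B ∣ ∸ ∣ A ∣) * c)
∑-covers-[⊆] [] [] c = refl
∑-covers-[⊆] (inside ∷ A) (inside ∷ B) c =
  trans (∑-map (inside ∷_) (covers A) _) (∑-covers-[⊆] A B c)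
∑-covers-[⊆] (inside ∷ A) (outside ∷ B) c =
  trans (∑-map (inside ∷_) (covers A) _) (trans (∑-const 0 (covers A)) (*-zeroʳ (length (covers A))))
∑-covers-[⊆] (outside ∷ A) (outside ∷ B) c =
  trans (∑-map (outside ∷_) (covers A) _) (∑-covers-[⊆] A B c)
∑-covers-[⊆] (outside ∷ A) (inside ∷ B) c
  rewrite ∑-map (outside ∷_) (covers A) (λ A′ → [ A′ ⊆ inside ∷ B ] * c) | ∑-covers-[⊆] A B c
  with [⊆]-view A B
... | inj₁ e rewrite e = refl
... | inj₂ (e , A⊆B) rewrite e | +-∸-assoc 1 (p⊆q⇒∣p∣≤∣q∣ A⊆B) = r c ((∣ B ∣ ∸ ∣ A ∣) * c)
  where
  r : ∀ c d → 1 * c + 1 * d ≡ 1 * (c + d)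
  r = solve-∀

-- A ⊆ B are joined by (∣ B ∣ ∸ ∣ A ∣) ! * ∣ ∁ B ∣ ! maximal chains from A upwards through B, out of ∣ ∁ A ∣ !.
chains : Subset n → Subset n → ℕ
chains A B = [ A ⊆ B ] * ((∣ B ∣ ∸ ∣ A ∣) ! * ∣ ∁ B ∣ !)

-- The leading factor of (∣B∣ - ∣A∣)! is split off so that the weight vanishes at B = A. This is
-- both `chains` restricted to strict supersets and the sum of `chains A′ B` over the covers A′ of
-- A.
chains⁺ : Subset n → Subset n → ℕ
chains⁺ A B = [ A ⊆ B ] * ((∣ B ∣ ∸ ∣ A ∣) * ((∣ B ∣ ∸ suc ∣ A ∣) ! * ∣ ∁ B ∣ !))

chains⁺≡∑-covers : (A B : Subset n) → chains⁺ A B ≡ ∑[ A′ ← covers A ] chains A′ B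
chains⁺≡∑-covers A B = trans (sym (∑-covers-[⊆] A B _))
  (∑-cong (covers A) λ {A′} A′∈ → cong (λ s → [ A′ ⊆ B ] * ((∣ B ∣ ∸ s) ! * ∣ ∁ B ∣ !)) (sym (covers-size A A′∈)))

m<n⇒[n∸m]*[n∸1+m]!≡[n∸m]! : ∀ {m n} → m < n → (n ∸ m) * (n ∸ suc m) ! ≡ (n ∸ m) !
m<n⇒[n∸m]*[n∸1+m]!≡[n∸m]! {zero}  {suc n} _         = refl
m<n⇒[n∸m]*[n∸1+m]!≡[n∸m]! {suc m} {suc n} (s≤s m<n) = m<n⇒[n∸m]*[n∸1+m]!≡[n∸m]! m<n

⊆∧≢⇒∣∣< : {A B : Subset n} → A ⊆ B → A ≢ B → ∣ A ∣ < ∣ B ∣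
⊆∧≢⇒∣∣< A⊆B A≢B = ≤∧≢⇒< (p⊆q⇒∣p∣≤∣q∣ A⊆B) λ e → A≢B (⊆∧∣∣≡⇒≡ A⊆B e)

chains≡chains⁺ : (A B : Subset n) → A ≢ B → chains A B ≡ chains⁺ A B
chains≡chains⁺ A B A≢B with [⊆]-view A B
... | inj₁ e rewrite e = refl
... | inj₂ (e , A⊆B) rewrite e = cong (1 *_) (begin
  (∣ B ∣ ∸ ∣ A ∣) ! * ∣ ∁ B ∣ !
    ≡⟨ cong (_* ∣ ∁ B ∣ !) (m<n⇒[n∸m]*[n∸1+m]!≡[n∸m]! (⊆∧≢⇒∣∣< A⊆B A≢B)) ⟨
  (∣ B ∣ ∸ ∣ A ∣) * (∣ B ∣ ∸ suc ∣ A ∣) ! * ∣ ∁ B ∣ !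
    ≡⟨ *-assoc (∣ B ∣ ∸ ∣ A ∣) ((∣ B ∣ ∸ suc ∣ A ∣) !) (∣ ∁ B ∣ !) ⟩
  (∣ B ∣ ∸ ∣ A ∣) * ((∣ B ∣ ∸ suc ∣ A ∣) ! * ∣ ∁ B ∣ !) ∎)
  where open ≡-Reasoning

chains-self : (A : Subset n) → chains A A ≡ ∣ ∁ A ∣ !
chains-self A rewrite [⊆]-refl A | n∸n≡0 ∣ A ∣ = r (∣ ∁ A ∣ !)
  where
  r : ∀ x → 1 * (1 * x) ≡ x
  r = solve-∀

chains-∅ : (B : Subset n) → chains ∅ B ≡ ∣ B ∣ ! * ∣ ∁ B ∣ !
chains-∅ {n} B = trans
  (cong₂ (λ i s → i * ((∣ B ∣ ∸ s) ! * ∣ ∁ B ∣ !)) ([∅⊆] B) (∣⊥∣≡0 n))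
  (*-identityˡ (∣ B ∣ ! * ∣ ∁ B ∣ !))

∑-chains-∉ : ∀ {𝓒 : List (Subset n)} {A} → A ∉ 𝓒 → ∑ 𝓒 (chains A) ≡ ∑ 𝓒 (chains⁺ A)
∑-chains-∉ {𝓒 = 𝓒} {A} A∉C = ∑-cong 𝓒 λ {B} B∈C → chains≡chains⁺ A B λ { refl → A∉C B∈C }

-- By uniqueness the term B = A, of weight `∣ ∁ A ∣ !`, occurs at most once; every other term equals
-- its strict version.
∑-chains-≤ : ∀ {𝓒 : List (Subset n)} → Unique 𝓒 → ∀ A → ∑ 𝓒 (chains A) ≤ ∣ ∁ A ∣ ! + ∑ 𝓒 (chains⁺ A)
∑-chains-≤ {𝓒 = []} _ A = z≤n
∑-chains-≤ {𝓒 = B ∷ 𝓒} (B∉C ∷ u) A with A ≟ˢ B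
... | yes refl = +-mono-≤ (≤-reflexive (chains-self A)) (≤-trans
  (≤-reflexive (∑-chains-∉ λ A∈C → All.lookup B∉C A∈C refl)) (m≤n+m _ (chains⁺ A A)))
... | no A≢B = begin
  chains A B + ∑ 𝓒 (chains A)                  ≤⟨ +-mono-≤ (≤-reflexive (chains≡chains⁺ A B A≢B)) (∑-chains-≤ u A) ⟩
  chains⁺ A B + (∣ ∁ A ∣ ! + ∑ 𝓒 (chains⁺ A))  ≡⟨ r (chains⁺ A B) (∣ ∁ A ∣ !) _ ⟩
  ∣ ∁ A ∣ ! + (chains⁺ A B + ∑ 𝓒 (chains⁺ A))  ∎
  where
  open ≤-Reasoning
  r : ∀ a b c → a + (b + c) ≡ b + (a + c)
  r = solve-∀

module _ (𝓒 : List (Subset n)) (u : Unique 𝓒) (M : ℕ)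
         (few : ∀ {A} → A ∈ 𝓒 → M * ∑ 𝓒 (chains⁺ A) ≤ ∣ ∁ A ∣ !) where

  open ≤-Reasoning

  -- Here 1/M is the ε, and `m !` counts the maximal chains from `A`. Only non-members recurse: for
  -- a member, `few` bounds everything strictly above it at once.
  ∑-chains-bound : ∀ m A → ∣ ∁ A ∣ ≡ m → M * ∑ 𝓒 (chains A) ≤ suc M * m !
  ∑-chains-bound m A ∣∁A∣≡m with A ∈ᴸ? 𝓒
  ... | yes A∈C = begin
    M * ∑ 𝓒 (chains A)                        ≤⟨ *-monoʳ-≤ M (∑-chains-≤ u A) ⟩
    M * (∣ ∁ A ∣ ! + ∑ 𝓒 (chains⁺ A))         ≡⟨ *-distribˡ-+ M (∣ ∁ A ∣ !) _ ⟩
    M * ∣ ∁ A ∣ ! + M * ∑ 𝓒 (chains⁺ A)       ≤⟨ +-monoʳ-≤ (M * ∣ ∁ A ∣ !) (few A∈C) ⟩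
    M * ∣ ∁ A ∣ ! + ∣ ∁ A ∣ !                 ≡⟨ +-comm (M * ∣ ∁ A ∣ !) _ ⟩
    suc M * ∣ ∁ A ∣ !                         ≡⟨ cong (λ k → suc M * k !) ∣∁A∣≡m ⟩
    suc M * m !                               ∎
  ... | no A∉C = begin
    M * ∑ 𝓒 (chains A)                              ≡⟨ cong (M *_) (∑-chains-∉ A∉C) ⟩
    M * ∑ 𝓒 (chains⁺ A)                             ≡⟨ cong (M *_) (∑-cong 𝓒 λ {B} _ → chains⁺≡∑-covers A B) ⟩
    M * ∑[ B ← 𝓒 ] ∑[ A′ ← covers A ] chains A′ B   ≡⟨ cong (M *_) (∑-comm 𝓒 (covers A) (λ B A′ → chains A′ B)) ⟩
    M * ∑[ A′ ← covers A ] ∑ 𝓒 (chains A′)          ≡⟨ ∑-*ˡ M (covers A) (λ A′ → ∑ 𝓒 (chains A′)) ⟨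
    ∑[ A′ ← covers A ] (M * ∑ 𝓒 (chains A′))        ≤⟨ over-covers m ∣∁A∣≡m ⟩
    suc M * m !                                     ∎
    where
    over-covers : ∀ m → ∣ ∁ A ∣ ≡ m → ∑[ A′ ← covers A ] (M * ∑ 𝓒 (chains A′)) ≤ suc M * m !
    over-covers zero e with covers A | length-covers A
    ... | []    | _ = z≤n
    ... | _ ∷ _ | l with trans l e
    ...   | ()
    over-covers (suc m) e = begin
      ∑[ A′ ← covers A ] (M * ∑ 𝓒 (chains A′))
        ≤⟨ ∑-mono-≤ (covers A) (λ {A′} A′∈ → ∑-chains-bound m A′ (suc-injective (trans (covers-cosize A A′∈) e))) ⟩
      ∑[ A′ ← covers A ] (suc M * m !)     ≡⟨ ∑-const (suc M * m !) (covers A) ⟩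
      length (covers A) * (suc M * m !)    ≡⟨ cong (_* (suc M * m !)) (trans (length-covers A) e) ⟩
      suc m * (suc M * m !)                ≡⟨ r (suc m) (suc M) (m !) ⟩
      suc M * (suc m * m !)                ∎
      where
      r : ∀ a b c → a * (b * c) ≡ b * (a * c)
      r = solve-∀

  -- The LYM argument: a member B lies on ∣B∣! ∣∁B∣! of the n! maximal chains from ∅, a fraction of
  -- at least 1 / mid n. Compare with the expectation bound at ∅.
  length-bound : M * length 𝓒 ≤ suc M * mid n
  length-bound = *-cancelʳ-≤ _ _ (n !) {{n !≢0}} (begin
    M * length 𝓒 * n !                            ≡⟨ *-assoc M (length 𝓒) (n !) ⟩
    M * (length 𝓒 * n !)                          ≡⟨ cong (M *_) (∑-const (n !) 𝓒) ⟨
    M * ∑[ B ← 𝓒 ] (n !)                          ≤⟨ *-monoʳ-≤ M (∑-mono-≤ 𝓒 λ {B} _ → n!≤ B) ⟩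
    M * ∑[ B ← 𝓒 ] (mid n * chains ∅ B)           ≡⟨ cong (M *_) (∑-*ˡ (mid n) 𝓒 (chains ∅)) ⟩
    M * (mid n * ∑ 𝓒 (chains ∅))                  ≡⟨ r₁ M (mid n) (∑ 𝓒 (chains ∅)) ⟩
    mid n * (M * ∑ 𝓒 (chains ∅))                  ≤⟨ *-monoʳ-≤ (mid n) (∑-chains-bound n ∅ ∣∁∅∣≡n) ⟩
    mid n * (suc M * n !)                         ≡⟨ r₂ (mid n) (suc M) (n !) ⟩
    suc M * mid n * n !                           ∎)
    where
    r₁ : ∀ a b c → a * (b * c) ≡ b * (a * c)
    r₁ = solve-∀
    r₂ : ∀ a b c → a * (b * c) ≡ b * a * c
    r₂ = solve-∀
    ∣∁∅∣≡n : ∣ ∁ (∅ {n}) ∣ ≡ n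
    ∣∁∅∣≡n = trans (cong (_+ ∣ ∁ (∅ {n}) ∣) (sym (∣⊥∣≡0 n))) (∣p∣+∣∁p∣≡n (∅ {n}))
    n!≤ : ∀ (B : Subset n) → n ! ≤ mid n * chains ∅ B
    n!≤ B = subst (λ c → n ! ≤ mid n * c) (sym (chains-∅ B))
      (subst (λ k → k ! ≤ mid k * (∣ B ∣ ! * ∣ ∁ B ∣ !)) (∣p∣+∣∁p∣≡n B) (!≤mid*!*! (∣ B ∣) (∣ ∁ B ∣)))

-- Every `x` of nonzero weight is charged to one level `d` that bounds it, and at most `δ` entries
-- are charged `h d` each.
∑-≤-by-levels : ∀ {A : Set} (xs : List A) (f : A → ℕ) N (h : ℕ → ℕ) δ {P : ℕ → A → Set} (P? : ∀ d → Decidable (P d)) →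
                (∀ {x} → x ∈ xs → f x ≡ 0 ⊎ ∃[ d ] d < N × P d x × f x ≤ h d) →
                (∀ d → length (filter (P? d) xs) ≤ δ) →
                ∑ xs f ≤ δ * ∑ (upTo N) h
∑-≤-by-levels {A} xs f N h δ {P} P? f≤h few = begin
  ∑ xs f                                       ≤⟨ ∑-mono-≤ xs f≤∑ ⟩
  ∑[ x ← xs ] ∑[ d ← upTo N ] at d x           ≡⟨ ∑-comm xs (upTo N) (λ x d → at d x) ⟩
  ∑[ d ← upTo N ] ∑[ x ← xs ] at d x           ≤⟨ ∑-mono-≤ (upTo N) (λ {d} _ → ≤-trans (≤-reflexive (∑-at d xs)) (*-monoˡ-≤ (h d) (few d))) ⟩
  ∑[ d ← upTo N ] (δ * h d)                    ≡⟨ ∑-*ˡ δ (upTo N) h ⟩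
  δ * ∑ (upTo N) h                             ∎
  where
  open ≤-Reasoning
  at : ℕ → A → ℕ
  at d x with P? d x
  ... | yes _ = h d
  ... | no  _ = 0
  ∑-at : ∀ d ys → ∑ ys (at d) ≡ length (filter (P? d) ys) * h d
  ∑-at d [] = refl
  ∑-at d (y ∷ ys) with P? d y
  ... | yes _ = cong (h d +_) (∑-at d ys)
  ... | no  _ = ∑-at d ys
  h≤at : ∀ {d x} → P d x → h d ≤ at d x
  h≤at {d} {x} p with P? d x
  ... | yes _ = ≤-refl
  ... | no ¬p = contradiction p ¬p
  f≤∑ : ∀ {x} → x ∈ xs → f x ≤ ∑[ d ← upTo N ] at d x
  f≤∑ {x} x∈ with f≤h x∈
  ... | inj₁ e = subst (_≤ ∑[ d ← upTo N ] at d x) (sym e) z≤n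
  ... | inj₂ (d , d<N , p , fx≤) = ≤-trans (≤-trans fx≤ (h≤at p)) (term≤∑ (λ d → at d x) (∈-upTo⁺ d<N))

-- The gap is d + 1, so that the inclusion is strict for every d.
Above : Subset n → ℕ → Subset n → Set
Above A d B = A ⊆ B × ∣ B ∣ ≡ suc d + ∣ A ∣

above? : (A : Subset n) → ∀ d → Decidable (Above A d)
above? A d B = (A ⊆? B) ×-dec (∣ B ∣ ≟ suc d + ∣ A ∣)

-- For ∣∁A∣ = p + 2, a set at gap d + 1 has weight (d+1)! (p+1-d)!: exactly (p+1)! at d = 0, and at
-- most 2 p! by `!*!-bound` for d ≥ 1 if two elements are still missing. With one or none missing,
-- the weight climbs back to (p+1)! or (p+2)!, which is why `chains⁺-view` assumes `2 ≤ ∣ ∁ B ∣`.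
levelBound : ℕ → ℕ → ℕ
levelBound p zero    = suc p !
levelBound p (suc _) = 2 * p !

chains⁺-view : ∀ (A B : Subset n) p → ∣ ∁ A ∣ ≡ 2 + p → 2 ≤ ∣ ∁ B ∣ →
               chains⁺ A B ≡ 0 ⊎
               ∃[ d ] d < suc p × Above A d B × chains⁺ A B ≤ levelBound p d
chains⁺-view {n} A B p ∣∁A∣≡ 2≤ with [⊆]-view A B
... | inj₁ e rewrite e = inj₁ refl
... | inj₂ (e , A⊆B) rewrite e with ∣ B ∣ ∸ ∣ A ∣ in eq
...   | zero  = inj₁ refl
...   | suc d = inj₂ (d , s≤s (≤-trans (n≤1+n d) d<p) , (A⊆B , ∣B∣≡) , bound)
  where
  open ≤-Reasoning
  ∣B∣≡ : ∣ B ∣ ≡ suc d + ∣ A ∣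
  ∣B∣≡ = trans (sym (m∸n+n≡m (p⊆q⇒∣p∣≤∣q∣ A⊆B))) (cong (_+ ∣ A ∣) eq)
  gap : suc d + ∣ ∁ B ∣ ≡ 2 + p
  gap = +-cancelˡ-≡ ∣ A ∣ _ _ (begin-equality
    ∣ A ∣ + (suc d + ∣ ∁ B ∣)  ≡⟨ r (∣ A ∣) d (∣ ∁ B ∣) ⟩
    suc d + ∣ A ∣ + ∣ ∁ B ∣    ≡⟨ cong (_+ ∣ ∁ B ∣) ∣B∣≡ ⟨
    ∣ B ∣ + ∣ ∁ B ∣            ≡⟨ trans (∣p∣+∣∁p∣≡n B) (sym (∣p∣+∣∁p∣≡n A)) ⟩
    ∣ A ∣ + ∣ ∁ A ∣            ≡⟨ cong (∣ A ∣ +_) ∣∁A∣≡ ⟩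
    ∣ A ∣ + (2 + p)            ∎)
    where
    r : ∀ a d b → a + (suc d + b) ≡ suc d + a + b
    r = solve-∀
  d<p : suc d ≤ p
  d<p = +-cancelʳ-≤ 2 (suc d) p (begin
    suc d + 2        ≤⟨ +-monoʳ-≤ (suc d) 2≤ ⟩
    suc d + ∣ ∁ B ∣  ≡⟨ gap ⟩
    2 + p            ≡⟨ +-comm 2 p ⟩
    p + 2            ∎)
  ∸suc : ∣ B ∣ ∸ suc ∣ A ∣ ≡ d
  ∸suc = trans (cong (_∸ suc ∣ A ∣) ∣B∣≡) (m+n∸n≡m d ∣ A ∣)
  gaps : ∀ d k → 2 ≤ k → suc d + k ≡ 2 + p → suc d ! * k ! ≤ levelBound p d
  gaps zero    k             _ e′ = ≤-reflexive (trans (+-identityʳ (k !)) (cong _! (suc-injective e′)))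
  gaps (suc d) (suc (suc k)) _ e′ = subst (λ q → (2 + d) ! * (2 + k) ! ≤ 2 * q !)
    (+-cancelˡ-≡ 2 _ _ (trans (r d k) e′)) (!*!-bound d k)
    where
    r : ∀ d k → 2 + (2 + d + k) ≡ suc (suc d) + suc (suc k)
    r = solve-∀
  gaps _ (suc zero) (s≤s ()) _
  bound : 1 * (suc d * ((∣ B ∣ ∸ suc ∣ A ∣) ! * ∣ ∁ B ∣ !)) ≤ _
  bound rewrite ∸suc | *-identityˡ (suc d * (d ! * ∣ ∁ B ∣ !)) | sym (*-assoc (suc d) (d !) (∣ ∁ B ∣ !)) =
    gaps d (∣ ∁ B ∣) 2≤ gap

-- The p levels beyond the first weigh 2 p! each, together at most twice the first level.
∑-levelBound : ∀ p → ∑ (upTo (suc p)) (levelBound p) ≤ 3 * suc p !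
∑-levelBound p = begin
  suc p ! + ∑ (applyUpTo suc p) (levelBound p)        ≡⟨ cong (suc p ! +_) (∑-cong (applyUpTo suc p) above-0) ⟩
  suc p ! + ∑[ _ ← applyUpTo suc p ] (2 * p !)        ≡⟨ cong (suc p ! +_) (∑-const (2 * p !) (applyUpTo suc p)) ⟩
  suc p ! + length (applyUpTo suc p) * (2 * p !)      ≡⟨ cong (λ l → suc p ! + l * (2 * p !)) (length-applyUpTo suc p) ⟩
  suc p ! + p * (2 * p !)                             ≤⟨ +-monoʳ-≤ (suc p !) (*-monoˡ-≤ (2 * p !) (n≤1+n p)) ⟩
  suc p ! + suc p * (2 * p !)                         ≡⟨ r (suc p) (p !) ⟩
  3 * suc p !                                         ∎
  where
  open ≤-Reasoning
  above-0 : ∀ {d} → d ∈ applyUpTo suc p → levelBound p d ≡ 2 * p !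
  above-0 d∈ with ∈-applyUpTo⁻ suc d∈
  ... | _ , _ , refl = refl
  r : ∀ a b → a * b + a * (2 * b) ≡ 3 * (a * b)
  r = solve-∀

-- If ∣∁A∣ = p + 2, the strict supersets of A in 𝓒 weigh at most 3 δ (p+1)!. Out of (p+2)! this is a
-- share of at most 1/M once `M * (3 * δ)` is no more than the number of missing elements.
supersaturation : ∀ (𝓒 : List (Subset n)) → Unique 𝓒 → ∀ M δ →
  (∀ {A} → A ∈ 𝓒 → 2 ≤ ∣ ∁ A ∣ × M * (3 * δ) ≤ ∣ ∁ A ∣) →
  (∀ {A} → A ∈ 𝓒 → ∀ d → length (filter (above? A d) 𝓒) ≤ δ) →
  M * length 𝓒 ≤ suc M * mid n
supersaturation 𝓒 u M δ high few = length-bound 𝓒 u M λ {A} A∈ → at A (∣ ∁ A ∣ ∸ 2) A∈ (sym (m+[n∸m]≡n (proj₁ (high A∈))))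
  where
  open ≤-Reasoning
  r : ∀ M δ q → M * (δ * (3 * q)) ≡ M * (3 * δ) * q
  r = solve-∀
  at : ∀ A p → A ∈ 𝓒 → ∣ ∁ A ∣ ≡ 2 + p → M * ∑ 𝓒 (chains⁺ A) ≤ ∣ ∁ A ∣ !
  at A p A∈ e = begin
    M * ∑ 𝓒 (chains⁺ A)                        ≤⟨ *-monoʳ-≤ M (∑-≤-by-levels 𝓒 (chains⁺ A) (suc p) (levelBound p) δ (above? A)
                                                    (λ {B} B∈ → chains⁺-view A B p e (proj₁ (high B∈))) (few A∈)) ⟩
    M * (δ * ∑ (upTo (suc p)) (levelBound p))  ≤⟨ *-monoʳ-≤ M (*-monoʳ-≤ δ (∑-levelBound p)) ⟩
    M * (δ * (3 * suc p !))                    ≡⟨ r M δ (suc p !) ⟩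
    M * (3 * δ) * suc p !                      ≤⟨ *-monoˡ-≤ (suc p !) (≤-trans (proj₂ (high A∈)) (≤-reflexive e)) ⟩
    (2 + p) !                                  ≡⟨ cong _! e ⟨
    ∣ ∁ A ∣ !                                  ∎

-- Containers

bernoulli : ∀ q j → (q + j) * q ^ j ≤ q * suc q ^ j
bernoulli q zero    = ≤-reflexive (cong (_* 1) (+-identityʳ q))
bernoulli q (suc j) = begin
  (q + suc j) * (q * q ^ j)         ≡⟨ *-assoc (q + suc j) q (q ^ j) ⟨
  (q + suc j) * q * q ^ j           ≤⟨ *-monoˡ-≤ (q ^ j) (m≤m+n ((q + suc j) * q) j) ⟩
  ((q + suc j) * q + j) * q ^ j     ≡⟨ r₁ q j (q ^ j) ⟩
  suc q * ((q + j) * q ^ j)         ≤⟨ *-monoʳ-≤ (suc q) (bernoulli q j) ⟩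
  suc q * (q * suc q ^ j)           ≡⟨ r₂ (suc q) q (suc q ^ j) ⟩
  q * (suc q * suc q ^ j)           ∎
  where
  open ≤-Reasoning
  r₁ : ∀ q j x → ((q + suc j) * q + j) * x ≡ suc q * ((q + j) * x)
  r₁ = solve-∀
  r₂ : ∀ a b c → a * (b * c) ≡ b * (a * c)
  r₂ = solve-∀

2*q^q≤[1+q]^q : ∀ q .{{_ : NonZero q}} → 2 * q ^ q ≤ suc q ^ q
2*q^q≤[1+q]^q q = *-cancelˡ-≤ q (≤-trans (≤-reflexive (r q (q ^ q))) (bernoulli q q))
  where
  r : ∀ q x → q * (2 * x) ≡ (q + q) * x
  r = solve-∀

-- Bernoulli's inequality (1 - 1/(q+1))^j ≥ 1 - j/(q+1), denominators cleared, with `e` for q + 1 -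
-- j. At j = (q+1)/2 it yields (1 + 1/q)^j ≤ 2.
bernoulli⁻ : ∀ q j e → j + e ≡ suc q → suc q ^ j * e ≤ suc q * q ^ j
bernoulli⁻ q zero    e eq = ≤-reflexive (trans (*-identityˡ e) (trans eq (sym (*-identityʳ (suc q)))))
bernoulli⁻ q (suc j) e eq = begin
  suc q * suc q ^ j * e         ≡⟨ r₁ q (suc q ^ j) e ⟩
  suc q ^ j * (q * e + e)       ≤⟨ *-monoʳ-≤ (suc q ^ j) (+-monoʳ-≤ (q * e) e≤q) ⟩
  suc q ^ j * (q * e + q)       ≡⟨ r₂ q (suc q ^ j) e ⟩
  q * (suc q ^ j * suc e)       ≤⟨ *-monoʳ-≤ q (bernoulli⁻ q j (suc e) (trans (+-suc j e) eq)) ⟩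
  q * (suc q * q ^ j)           ≡⟨ r₃ q (suc q) (q ^ j) ⟩
  suc q * (q * q ^ j)           ∎
  where
  open ≤-Reasoning
  e≤q : e ≤ q
  e≤q = ≤-trans (m≤n+m e j) (≤-reflexive (suc-injective eq))
  r₁ : ∀ q x e → suc q * x * e ≡ x * (q * e + e)
  r₁ = solve-∀
  r₂ : ∀ q x e → x * (q * e + q) ≡ q * (x * suc e)
  r₂ = solve-∀
  r₃ : ∀ a b c → a * (b * c) ≡ b * (a * c)
  r₃ = solve-∀

[1+q]^h≤2*q^h : ∀ q h .{{_ : NonZero h}} → suc q ≡ h + h → suc q ^ h ≤ 2 * q ^ h
[1+q]^h≤2*q^h q h eq = *-cancelʳ-≤ _ _ h (begin
  suc q ^ h * h    ≤⟨ bernoulli⁻ q h h (sym eq) ⟩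
  suc q * q ^ h    ≡⟨ cong (_* q ^ h) eq ⟩
  (h + h) * q ^ h  ≡⟨ r h (q ^ h) ⟩
  2 * q ^ h * h    ∎)
  where
  open ≤-Reasoning
  r : ∀ h x → (h + h) * x ≡ 2 * x * h
  r = solve-∀

short : ℕ → List X → List (List X)
short zero    _        = [] ∷ []
short (suc D) []       = [] ∷ []
short (suc D) (x ∷ xs) = short (suc D) xs ++ map (x ∷_) (short D xs)

-- A sublist with at most `D` entries amounts to `D` choices of an entry or none. For fixed `D` this
-- is only polynomial in the length.
length-short : ∀ D (xs : List X) → length (short D xs) ≤ suc (length xs) ^ D
length-short zero    _        = ≤-refl
length-short (suc D) []       = ≤-reflexive (sym (^-zeroˡ (suc D)))
length-short (suc D) (x ∷ xs) = begin
  length (short (suc D) xs ++ map (x ∷_) (short D xs))  ≡⟨ length-++ (short (suc D) xs) ⟩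
  length (short (suc D) xs) + length (map (x ∷_) (short D xs))
    ≡⟨ cong (length (short (suc D) xs) +_) (length-map (x ∷_) (short D xs)) ⟩
  length (short (suc D) xs) + length (short D xs)       ≤⟨ +-mono-≤ (length-short (suc D) xs) (length-short D xs) ⟩
  suc l * suc l ^ D + suc l ^ D                         ≡⟨ +-comm (suc l * suc l ^ D) _ ⟩
  suc (suc l) * suc l ^ D                               ≤⟨ *-monoʳ-≤ (suc (suc l)) (^-monoˡ-≤ D (n≤1+n (suc l))) ⟩
  suc (suc l) ^ suc D                                   ∎
  where
  open ≤-Reasoning
  l = length xs

∈-short : ∀ D {xs ys : List X} → ys ⊑ xs → length ys ≤ D → ys ∈ short D xs
∈-short zero    {ys = []} _         _         = here refl
∈-short (suc D) []                  _         = here refl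
∈-short (suc D) (x ∷ʳ p)            l         = ∈-++⁺ˡ (∈-short (suc D) p l)
∈-short (suc D) {x ∷ xs} (refl ∷ p) (s≤s l)   = ∈-++⁺ʳ (short (suc D) xs) (∈-map⁺ (x ∷_) (∈-short D p l))

-- Sets on one level form an antichain, so an induced ∨_{D+1}-free family is sparse.
Sparse : ℕ → Family n → Set
Sparse D F = ∀ {A} → A ∈ F → ∀ d S → Unique S → (∀ {B} → B ∈ S → B ∈ F × Above A d B) → length S ≤ D

sparse-⊆ : ∀ {D} {F G : Family n} → G ⊆ᴸ F → Sparse D F → Sparse D G
sparse-⊆ G⊆F sp A∈ d S u S⊆ = sp (G⊆F A∈) d S u (λ B∈ → G⊆F (proj₁ (S⊆ B∈)) , proj₂ (S⊆ B∈))

-- Covering families are assembled by concatenation, so they are compared without regard to order or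
-- repetition.
_≐_ : Family n → Family n → Set
F ≐ G = F ⊆ᴸ G × G ⊆ᴸ F

-- `𝒟` enumerates the candidate families themselves. In `containers` a container enters through all
-- its sublists, so that one length bounds the containers together with their subfamilies.
Covers : ℕ → List (Subset n) → List (Family n) → Set
Covers D 𝓒 𝒟 = ∀ {F} → Sparse D F → F ⊆ᴸ 𝓒 → ∃[ G ] G ∈ 𝒟 × F ≐ G

sublists-cover : ∀ {F 𝓒 : Family n} → F ⊆ᴸ 𝓒 → ∃[ G ] G ∈ sublists 𝓒 × F ≐ G
sublists-cover {F = F} {𝓒} F⊆ = filter (_∈ᴸ? F) 𝓒 , ∈-sublists⁺ (filter-⊆ (_∈ᴸ? F) 𝓒) ,
  (λ x∈ → ∈-filter⁺ (_∈ᴸ? F) (F⊆ x∈) x∈) , (λ x∈ → proj₂ (∈-filter⁻ (_∈ᴸ? F) {xs = 𝓒} x∈))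

-- A sparse F either misses A, or contains A and at most D of the δ sets S above A; in the second case
-- there are at most (1 + δ)^D possibilities for F ∩ S, and the rest of F lives outside A and S.
module Split (D δ : ℕ) (𝓒 : List (Subset n)) (u : Unique 𝓒) {A : Subset n} (A∈𝓒 : A ∈ 𝓒)
             (d : ℕ) (many : δ < length (filter (above? A d) 𝓒)) where

  -- Cutting down to exactly `δ` sets makes the number removed and the count of possible traces
  -- independent of how crowded `A` is.
  S : List (Subset n)
  S = take δ (filter (above? A d) 𝓒)

  length-S : length S ≡ δ
  length-S = trans (length-take δ (filter (above? A d) 𝓒)) (m≤n⇒m⊓n≡m (<⇒≤ many))

  S-unique : Unique S
  S-unique = Uniqueₚ.take⁺ δ (Uniqueₚ.filter⁺ (above? A d) u)

  S⊆ : ∀ {B} → B ∈ S → B ∈ 𝓒 × Above A d B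
  S⊆ B∈ = ∈-filter⁻ (above? A d) {xs = 𝓒} (Sub.lookup (take-⊆ δ _) B∈)

  ≢A? : Decidable (λ (B : Subset n) → ¬ B ≡ A)
  ≢A? B = ¬? (B ≟ˢ A)

  ∉S? : Decidable (λ (B : Subset n) → B ∉ S)
  ∉S? B = ¬? (B ∈ᴸ? S)

  𝓒₁ 𝓒₂ : List (Subset n)
  𝓒₁ = filter ≢A? 𝓒
  𝓒₂ = filter ∉S? 𝓒₁

  𝓒₁-unique : Unique 𝓒₁
  𝓒₁-unique = Uniqueₚ.filter⁺ ≢A? u

  𝓒₁⊆𝓒 : 𝓒₁ ⊆ᴸ 𝓒
  𝓒₁⊆𝓒 B∈ = proj₁ (∈-filter⁻ ≢A? {xs = 𝓒} B∈)

  𝓒₂⊆𝓒₁ : 𝓒₂ ⊆ᴸ 𝓒₁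
  𝓒₂⊆𝓒₁ B∈ = proj₁ (∈-filter⁻ ∉S? {xs = 𝓒₁} B∈)

  length-𝓒₁ : suc (length 𝓒₁) ≤ length 𝓒
  length-𝓒₁ = length-⊆ {xs = A ∷ 𝓒₁}
    (All.tabulate (λ B∈ A≡B → proj₂ (∈-filter⁻ ≢A? {xs = 𝓒} B∈) (sym A≡B)) ∷ 𝓒₁-unique)
    λ { (here refl) → A∈𝓒 ; (there B∈) → 𝓒₁⊆𝓒 B∈ }

  length-𝓒₂ : δ + length 𝓒₂ ≤ length 𝓒₁
  length-𝓒₂ = subst (_≤ length 𝓒₁) (trans (length-++ S) (cong (_+ length 𝓒₂) length-S))
    (length-⊆ {xs = S ++ 𝓒₂}
      (Uniqueₚ.++⁺ S-unique (Uniqueₚ.filter⁺ ∉S? 𝓒₁-unique) λ (p , q) → proj₂ (∈-filter⁻ ∉S? {xs = 𝓒₁} q) p)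
      λ B∈ → [ S⊆𝓒₁ , 𝓒₂⊆𝓒₁ ]′ (∈-++⁻ S B∈))
    where
    S⊆𝓒₁ : S ⊆ᴸ 𝓒₁
    S⊆𝓒₁ B∈ = ∈-filter⁺ ≢A? (proj₁ (S⊆ B∈))
      λ { refl → m≢1+n+m _ (proj₂ (proj₂ (S⊆ B∈))) }

  merge : List (Subset n) → Family n → Family n
  merge T G = A ∷ T ++ G

  step-covers : ∀ {𝒟₁ 𝒟₂} → Covers D 𝓒₁ 𝒟₁ → Covers D 𝓒₂ 𝒟₂ →
                Covers D 𝓒 (𝒟₁ ++ cartesianProductWith merge (short D S) 𝒟₂)
  step-covers {𝒟₁} {𝒟₂} cov₁ cov₂ {F} sp F⊆ with A ∈ᴸ? F
  ... | no A∉F with cov₁ sp (λ B∈ → ∈-filter⁺ ≢A? (F⊆ B∈) λ { refl → A∉F B∈ })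
  ...   | G , G∈ , F≐G = G , ∈-++⁺ˡ G∈ , F≐G
  step-covers {𝒟₁} {𝒟₂} cov₁ cov₂ {F} sp F⊆ | yes A∈F
    with cov₂ (sparse-⊆ F₂⊆F sp) (λ B∈ → proj₂ (∈-filter⁻ (_∈ᴸ? 𝓒₂) {xs = F} B∈))
    where
    F₂⊆F : filter (_∈ᴸ? 𝓒₂) F ⊆ᴸ F
    F₂⊆F B∈ = proj₁ (∈-filter⁻ (_∈ᴸ? 𝓒₂) {xs = F} B∈)
  ... | G , G∈ , F₂⊆G , G⊆F₂ =
    merge T G , ∈-++⁺ʳ 𝒟₁ (∈-cartesianProductWith⁺ merge T∈ G∈) , F⊆merge , merge⊆F
    where
    T = filter (_∈ᴸ? F) S
    T⊆ : ∀ {B} → B ∈ T → B ∈ S × B ∈ F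
    T⊆ B∈ = ∈-filter⁻ (_∈ᴸ? F) {xs = S} B∈
    T∈ : T ∈ short D S
    T∈ = ∈-short D (filter-⊆ (_∈ᴸ? F) S) (sp A∈F d T (Uniqueₚ.filter⁺ (_∈ᴸ? F) S-unique)
      λ B∈ → proj₂ (T⊆ B∈) , proj₂ (S⊆ (proj₁ (T⊆ B∈))))
    F⊆merge : F ⊆ᴸ merge T G
    F⊆merge {B} B∈ with B ≟ˢ A | B ∈ᴸ? S
    ... | yes refl | _       = here refl
    ... | no B≢A   | yes B∈S = there (∈-++⁺ˡ (∈-filter⁺ (_∈ᴸ? F) B∈S B∈))
    ... | no B≢A   | no B∉S  = there (∈-++⁺ʳ T (F₂⊆G (∈-filter⁺ (_∈ᴸ? 𝓒₂) B∈
      (∈-filter⁺ ∉S? (∈-filter⁺ ≢A? (F⊆ B∈) B≢A) B∉S))))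
    merge⊆F : merge T G ⊆ᴸ F
    merge⊆F (here refl) = A∈F
    merge⊆F (there B∈) = [ (λ p → proj₂ (T⊆ p)) , (λ p → proj₁ (∈-filter⁻ (_∈ᴸ? 𝓒₂) {xs = F} (G⊆F₂ p))) ]′ (∈-++⁻ T B∈)

  length-step : ∀ 𝒟₁ 𝒟₂ → length (𝒟₁ ++ cartesianProductWith merge (short D S) 𝒟₂) ≤ length 𝒟₁ + suc δ ^ D * length 𝒟₂
  length-step 𝒟₁ 𝒟₂ = begin
    length (𝒟₁ ++ P)                                   ≡⟨ length-++ 𝒟₁ ⟩
    length 𝒟₁ + length P                               ≡⟨ cong (length 𝒟₁ +_) (length-cartesianProductWith merge (short D S) 𝒟₂) ⟩
    length 𝒟₁ + length (short D S) * length 𝒟₂         ≤⟨ +-monoʳ-≤ (length 𝒟₁) (*-monoˡ-≤ (length 𝒟₂) (length-short D S)) ⟩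
    length 𝒟₁ + suc (length S) ^ D * length 𝒟₂         ≡⟨ cong (λ l → length 𝒟₁ + suc l ^ D * length 𝒟₂) length-S ⟩
    length 𝒟₁ + suc δ ^ D * length 𝒟₂                  ∎
    where
    open ≤-Reasoning
    P = cartesianProductWith merge (short D S) 𝒟₂

Crowded : ℕ → List (Subset n) → Subset n → Set
Crowded δ 𝓒 A = ∃[ d ] δ < length (filter (above? A d) 𝓒)

-- A set above `A` at gap d + 1 has at least d + 1 elements, so only the levels `d < n` need to be
-- searched.
crowded? : ∀ δ (𝓒 : List (Subset n)) → Decidable (Crowded δ 𝓒)
crowded? {n} δ 𝓒 A with anyUpTo? (λ d → δ <? length (filter (above? A d) 𝓒)) n
... | yes (d , _ , many) = yes (d , many)
... | no ¬p = no λ (d , many) → few d many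
  where
  few : ∀ d → ¬ δ < length (filter (above? A d) 𝓒)
  few d many with d <? n
  ... | yes d<n = ¬p (d , d<n , many)
  ... | no  d≮n with filter (above? A d) 𝓒 | many | (λ {B} → ∈-filter⁻ (above? A d) {v = B} {xs = 𝓒})
  ...   | []    | () | _
  ...   | B ∷ _ | _  | mem with mem (here refl)
  ...     | _ , _ , e = contradiction
    (≤-trans (≤-trans (m≤m+n (suc d) ∣ A ∣) (≤-reflexive (sym e))) (∣p∣≤n B)) d≮n

-- Put x = 1 + 1/q. The claim is N₁ + K N₂ ≤ x^(δ+c+1) W, which follows from x^(δ+1) = x^δ + x^δ / q
-- and K ≤ x^δ / q, the content of `hK`.
weighted-step : ∀ q δ K c N₁ N₂ W → K * (q * q ^ δ) ≤ suc q ^ δ →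
                N₁ * q ^ (δ + c) ≤ suc q ^ (δ + c) * W → N₂ * q ^ c ≤ suc q ^ c * W →
                (N₁ + K * N₂) * q ^ suc (δ + c) ≤ suc q ^ suc (δ + c) * W
weighted-step q δ K c N₁ N₂ W hK h₁ h₂ = begin
  (N₁ + K * N₂) * (q * q ^ (δ + c))                            ≡⟨ r₁ N₁ (K * N₂) q (q ^ (δ + c)) ⟩
  q * (N₁ * q ^ (δ + c)) + K * N₂ * (q * q ^ (δ + c))          ≡⟨ cong (λ x → q * (N₁ * q ^ (δ + c)) + K * N₂ * (q * x)) (^-distribˡ-+-* q δ c) ⟩
  q * (N₁ * q ^ (δ + c)) + K * N₂ * (q * (q ^ δ * q ^ c))      ≡⟨ cong (q * (N₁ * q ^ (δ + c)) +_) (r₂ K N₂ q (q ^ δ) (q ^ c)) ⟩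
  q * (N₁ * q ^ (δ + c)) + (K * (q * q ^ δ)) * (N₂ * q ^ c)    ≤⟨ +-mono-≤ (*-monoʳ-≤ q h₁) (*-mono-≤ hK h₂) ⟩
  q * (suc q ^ (δ + c) * W) + suc q ^ δ * (suc q ^ c * W)      ≡⟨ cong (q * (suc q ^ (δ + c) * W) +_) (*-assoc (suc q ^ δ) (suc q ^ c) W) ⟨
  q * (suc q ^ (δ + c) * W) + suc q ^ δ * suc q ^ c * W        ≡⟨ cong (λ x → q * (suc q ^ (δ + c) * W) + x * W) (^-distribˡ-+-* (suc q) δ c) ⟨
  q * (suc q ^ (δ + c) * W) + suc q ^ (δ + c) * W              ≡⟨ r₃ q (suc q ^ (δ + c)) W ⟩
  suc q * suc q ^ (δ + c) * W                                  ∎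
  where
  open ≤-Reasoning
  r₁ : ∀ a b q x → (a + b) * (q * x) ≡ q * (a * x) + b * (q * x)
  r₁ = solve-∀
  r₂ : ∀ K N q x y → K * N * (q * (x * y)) ≡ (K * (q * x)) * (N * y)
  r₂ = solve-∀
  r₃ : ∀ q x W → q * (x * W) + x * W ≡ suc q * x * W
  r₃ = solve-∀

module _ (D δ M q W : ℕ) (hK : suc δ ^ D * (q * q ^ δ) ≤ suc q ^ δ)
         (hW : ∀ l → M * l ≤ suc M * mid n → 2 ^ l ≤ W) where

  -- The bound is (1 + 1/q)^c W: the weight hypothesis hK says that x = 1 + 1/q satisfies
  -- x^(δ+1) ≥ x^δ + (1 + δ)^D, the recursion for the two branches of Split.
  containers : ∀ {c} → Acc _<_ c → ∀ (𝓒 : List (Subset n)) → Unique 𝓒 → length 𝓒 ≤ c →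
    (∀ {A} → A ∈ 𝓒 → 2 ≤ ∣ ∁ A ∣ × M * (3 * δ) ≤ ∣ ∁ A ∣) →
    ∃[ 𝒟 ] Covers D 𝓒 𝒟 × length 𝒟 * q ^ c ≤ suc q ^ c * W
  containers {c} _ 𝓒 u l≤c high with any? (crowded? δ 𝓒) 𝓒
  ... | no ¬crowded = sublists 𝓒 , (λ _ F⊆ → sublists-cover F⊆) , (begin
    length (sublists 𝓒) * q ^ c   ≡⟨ cong (_* q ^ c) (length-sublists 𝓒) ⟩
    2 ^ length 𝓒 * q ^ c          ≤⟨ *-mono-≤ (hW (length 𝓒) (supersaturation 𝓒 u M δ high (λ A∈ d → ≮⇒≥ λ many → ¬crowded (lose A∈ (d , many))))) (^-monoˡ-≤ c (n≤1+n q)) ⟩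
    W * suc q ^ c                 ≡⟨ *-comm W (suc q ^ c) ⟩
    suc q ^ c * W                 ∎)
    where open ≤-Reasoning
  containers {zero} _ (_ ∷ _) _ () _ | yes _
  containers {zero} _ [] _ _ _ | yes ()
  containers {suc c} (acc rs) 𝓒 u l≤c high | yes p =
    let A , A∈ , d , many = find p
        open Split D δ 𝓒 u A∈ d many
        l₁ = s≤s⁻¹ (≤-trans length-𝓒₁ l≤c)
        -- `𝓒₁` still contains the δ sets of `S`, so δ ≤ c and the truncated subtraction is exact.
        c≡ = m+[n∸m]≡n (≤-trans (m≤m+n δ (length 𝓒₂)) (≤-trans length-𝓒₂ l₁))
        l₂ = +-cancelˡ-≤ δ (length 𝓒₂) (c ∸ δ) (≤-trans length-𝓒₂ (≤-trans l₁ (≤-reflexive (sym c≡))))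
        𝒟₁ , cov₁ , h₁ = containers (rs ≤-refl) 𝓒₁ 𝓒₁-unique l₁ (high ∘ 𝓒₁⊆𝓒)
        𝒟₂ , cov₂ , h₂ = containers (rs (s≤s (m∸n≤m c δ))) 𝓒₂ (Uniqueₚ.filter⁺ ∉S? 𝓒₁-unique) l₂ (high ∘ 𝓒₁⊆𝓒 ∘ 𝓒₂⊆𝓒₁)
    in 𝒟₁ ++ cartesianProductWith merge (short D S) 𝒟₂ , step-covers cov₁ cov₂ ,
       ≤-trans (*-monoˡ-≤ (q ^ suc c) (length-step 𝒟₁ 𝒟₂))
         (subst (λ k → (length 𝒟₁ + suc δ ^ D * length 𝒟₂) * q ^ suc k ≤ suc q ^ suc k * W) c≡
           (weighted-step q δ (suc δ ^ D) (c ∸ δ) (length 𝒟₁) (length 𝒟₂) W hK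
             (subst (λ k → length 𝒟₁ * q ^ k ≤ suc q ^ k * W) (sym c≡) h₁) h₂))

-- Variance of the set size

∈-allSubsets : (p : Subset n) → p ∈ allSubsets n
∈-allSubsets []            = here refl
∈-allSubsets (outside ∷ p) = ∈-++⁺ˡ (∈-map⁺ (outside ∷_) (∈-allSubsets p))
∈-allSubsets {suc n} (inside ∷ p) = ∈-++⁺ʳ (map (outside ∷_) (allSubsets n)) (∈-map⁺ (inside ∷_) (∈-allSubsets p))

allSubsets-unique : ∀ n → Unique (allSubsets n)
allSubsets-unique zero    = [] ∷ []
allSubsets-unique (suc n) = Uniqueₚ.++⁺
  (Uniqueₚ.map⁺ (λ { refl → refl }) (allSubsets-unique n))
  (Uniqueₚ.map⁺ (λ { refl → refl }) (allSubsets-unique n))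
  disjoint
  where
  disjoint : ∀ {p} → p ∈ map (outside ∷_) (allSubsets n) × p ∈ map (inside ∷_) (allSubsets n) → ⊥
  disjoint (p∈ , q∈) with ∈-map⁻ (outside ∷_) p∈ | ∈-map⁻ (inside ∷_) q∈
  ... | _ , _ , refl | _ , _ , ()

∑-allSubsets : ∀ n (f : Subset (suc n) → ℕ) →
               ∑ (allSubsets (suc n)) f ≡ ∑[ p ← allSubsets n ] (f (outside ∷ p) + f (inside ∷ p))
∑-allSubsets n f = begin
  ∑ (allSubsets (suc n)) f
    ≡⟨ ∑-++ (map (outside ∷_) (allSubsets n)) (map (inside ∷_) (allSubsets n)) f ⟩
  ∑ (map (outside ∷_) (allSubsets n)) f + ∑ (map (inside ∷_) (allSubsets n)) f
    ≡⟨ cong₂ _+_ (∑-map (outside ∷_) (allSubsets n) f) (∑-map (inside ∷_) (allSubsets n) f) ⟩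
  ∑[ p ← allSubsets n ] f (outside ∷ p) + ∑[ p ← allSubsets n ] f (inside ∷ p)
    ≡⟨ ∑-distrib-+ (allSubsets n) (λ p → f (outside ∷ p)) (λ p → f (inside ∷ p)) ⟨
  ∑[ p ← allSubsets n ] (f (outside ∷ p) + f (inside ∷ p)) ∎
  where open ≡-Reasoning

length-allSubsets : ∀ n → length (allSubsets n) ≡ 2 ^ n
length-allSubsets zero    = refl
length-allSubsets (suc n) = begin
  length (allSubsets (suc n))                   ≡⟨ length-++ (map (outside ∷_) (allSubsets n)) ⟩
  length (map (outside ∷_) (allSubsets n)) + length (map (inside ∷_) (allSubsets n))
    ≡⟨ cong₂ _+_ (trans (length-map _ (allSubsets n)) (length-allSubsets n)) (trans (length-map _ (allSubsets n)) (length-allSubsets n)) ⟩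
  2 ^ n + 2 ^ n                                 ≡⟨ cong (2 ^ n +_) (+-identityʳ (2 ^ n)) ⟨
  2 ^ suc n                                     ∎
  where open ≡-Reasoning

squares products : Subset n → ℕ
squares p  = ∣ p ∣ * ∣ p ∣ + ∣ ∁ p ∣ * ∣ ∁ p ∣
products p = 2 * (∣ p ∣ * ∣ ∁ p ∣)

-- The variance Σ (∣ p ∣ - ∣ ∁ p ∣)² = n 2ⁿ, with the cross terms moved to the right.
variance : ∀ n → ∑ (allSubsets n) squares ≡ ∑ (allSubsets n) products + n * 2 ^ n
variance zero    = refl
variance (suc n) = begin
  ∑ (allSubsets (suc n)) squares
    ≡⟨ ∑-allSubsets n squares ⟩
  ∑[ p ← allSubsets n ] (squares (outside ∷ p) + squares (inside ∷ p))
    ≡⟨ ∑-cong (allSubsets n) (λ {p} _ → trans (r₁ (∣ p ∣) (∣ ∁ p ∣)) (cong (λ m → 2 * squares p + (2 * m + 2)) (∣p∣+∣∁p∣≡n p))) ⟩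
  ∑[ p ← allSubsets n ] (2 * squares p + (2 * n + 2))
    ≡⟨ affine squares (2 * n + 2) ⟩
  2 * ∑ (allSubsets n) squares + 2 ^ n * (2 * n + 2)
    ≡⟨ cong (λ x → 2 * x + 2 ^ n * (2 * n + 2)) (variance n) ⟩
  2 * (∑ (allSubsets n) products + n * 2 ^ n) + 2 ^ n * (2 * n + 2)
    ≡⟨ r₃ (∑ (allSubsets n) products) n (2 ^ n) ⟩
  2 * ∑ (allSubsets n) products + 2 ^ n * (2 * n) + suc n * (2 * 2 ^ n)
    ≡⟨ cong (_+ suc n * (2 * 2 ^ n)) (affine products (2 * n)) ⟨
  ∑[ p ← allSubsets n ] (2 * products p + 2 * n) + suc n * 2 ^ suc n
    ≡⟨ cong (_+ suc n * 2 ^ suc n) (∑-cong (allSubsets n) (λ {p} _ → trans (r₂ (∣ p ∣) (∣ ∁ p ∣)) (cong (λ m → 2 * products p + 2 * m) (∣p∣+∣∁p∣≡n p)))) ⟨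
  ∑[ p ← allSubsets n ] (products (outside ∷ p) + products (inside ∷ p)) + suc n * 2 ^ suc n
    ≡⟨ cong (_+ suc n * 2 ^ suc n) (∑-allSubsets n products) ⟨
  ∑ (allSubsets (suc n)) products + suc n * 2 ^ suc n ∎
  where
  open ≡-Reasoning
  affine : ∀ (f : Subset n → ℕ) c → ∑[ p ← allSubsets n ] (2 * f p + c) ≡ 2 * ∑ (allSubsets n) f + 2 ^ n * c
  affine f c = trans (∑-distrib-+ (allSubsets n) (λ p → 2 * f p) (λ _ → c))
    (cong₂ _+_ (∑-*ˡ 2 (allSubsets n) f) (trans (∑-const c (allSubsets n)) (cong (_* c) (length-allSubsets n))))
  r₁ : ∀ a b → (a * a + suc b * suc b) + (suc a * suc a + b * b) ≡ 2 * (a * a + b * b) + (2 * (a + b) + 2)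
  r₁ = solve-∀
  r₂ : ∀ a b → 2 * (a * suc b) + 2 * (suc a * b) ≡ 2 * (2 * (a * b)) + 2 * (a + b)
  r₂ = solve-∀
  r₃ : ∀ Y n t → 2 * (Y + n * t) + t * (2 * n + 2) ≡ 2 * Y + t * (2 * n) + suc n * (2 * t)
  r₃ = solve-∀

-- Markov's inequality for f - g, which is nonnegative everywhere and at least `c` on `P`, with the
-- sum of `g` moved to the left.
∑-filter-≤ : ∀ {P : X → Set} (P? : Decidable P) xs {f g : X → ℕ} c →
             (∀ x → g x ≤ f x) → (∀ x → P x → c + g x ≤ f x) →
             length (filter P? xs) * c + ∑ xs g ≤ ∑ xs f
∑-filter-≤ P? []       c g≤f c+g≤f = z≤n
∑-filter-≤ P? (x ∷ xs) {f} {g} c g≤f c+g≤f with P? x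
... | yes p = ≤-trans (≤-reflexive (r c (length (filter P? xs) * c) (g x) (∑ xs g)))
                (+-mono-≤ (c+g≤f x p) (∑-filter-≤ P? xs c g≤f c+g≤f))
  where
  r : ∀ a b c d → a + b + (c + d) ≡ a + c + (b + d)
  r = solve-∀
... | no  _ = ≤-trans (≤-reflexive (r (length (filter P? xs) * c) (g x) (∑ xs g)))
                (+-mono-≤ (g≤f x) (∑-filter-≤ P? xs c g≤f c+g≤f))
  where
  r : ∀ b c d → b + (c + d) ≡ c + (b + d)
  r = solve-∀

-- The bound n/4 is a fixed proportion below the mean n/2 of ∣∁p∣, so Chebyshev leaves out only
-- O(2^n / n) sets, while every remaining set misses a number of elements linear in n.
High : Subset n → Set
High {n} p = n ≤ 4 * ∣ ∁ p ∣

high? : Decidable (High {n})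
high? {n} p = n ≤? 4 * ∣ ∁ p ∣

tail : ∀ n → List (Subset n)
tail n = filter (¬? ∘ high?) (allSubsets n)

8*products≤ : ∀ a b → 4 * (2 * (a * b)) ≤ 4 * (a * a + b * b)
8*products≤ a b with ≤-total a b
... | inj₁ a≤b = subst (λ b → 4 * (2 * (a * b)) ≤ 4 * (a * a + b * b)) (m+[n∸m]≡n a≤b)
  (≤-trans (m≤m+n _ (4 * ((b ∸ a) * (b ∸ a)))) (≤-reflexive (r a (b ∸ a))))
  where
  r : ∀ a d → 4 * (2 * (a * (a + d))) + 4 * (d * d) ≡ 4 * (a * a + (a + d) * (a + d))
  r = solve-∀
... | inj₂ b≤a = subst (λ a → 4 * (2 * (a * b)) ≤ 4 * (a * a + b * b)) (m+[n∸m]≡n b≤a)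
  (≤-trans (m≤m+n _ (4 * ((a ∸ b) * (a ∸ b)))) (≤-reflexive (r b (a ∸ b))))
  where
  r : ∀ b d → 4 * (2 * ((b + d) * b)) + 4 * (d * d) ≡ 4 * ((b + d) * (b + d) + b * b)
  r = solve-∀

-- From a ≥ 3b one gets a - b ≥ (a + b)/2, hence (a + b)² ≤ 4 (a - b)²; the cross terms are moved to
-- the left.
tail-pointwise : ∀ a b → 3 * b ≤ a → (a + b) * (a + b) + 4 * (2 * (a * b)) ≤ 4 * (a * a + b * b)
tail-pointwise a b 3b≤a = subst (λ a → (a + b) * (a + b) + 4 * (2 * (a * b)) ≤ 4 * (a * a + b * b)) (m+[n∸m]≡n 3b≤a)
  (≤-trans (m≤m+n _ (8 * (b * e) + 3 * (e * e))) (≤-reflexive (r b e)))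
  where
  e = a ∸ 3 * b
  r : ∀ b e → (3 * b + e + b) * (3 * b + e + b) + 4 * (2 * ((3 * b + e) * b)) + (8 * (b * e) + 3 * (e * e))
            ≡ 4 * ((3 * b + e) * (3 * b + e) + b * b)
  r = solve-∀

length-tail : ∀ n .{{_ : NonZero n}} → n * length (tail n) ≤ 4 * 2 ^ n
length-tail n = *-cancelˡ-≤ n (+-cancelʳ-≤ (4 * cross) _ _ (begin
  n * (n * length (tail n)) + 4 * cross                     ≡⟨ cong₂ _+_ (r₁ n (length (tail n))) (sym (∑-*ˡ 4 (allSubsets n) products)) ⟩
  length (tail n) * (n * n) + ∑[ p ← allSubsets n ] (4 * products p)
    ≤⟨ ∑-filter-≤ (¬? ∘ high?) (allSubsets n) (n * n) (λ p → 8*products≤ (∣ p ∣) (∣ ∁ p ∣)) low ⟩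
  ∑[ p ← allSubsets n ] (4 * squares p)                 ≡⟨ ∑-*ˡ 4 (allSubsets n) squares ⟩
  4 * ∑ (allSubsets n) squares                          ≡⟨ cong (4 *_) (variance n) ⟩
  4 * (cross + n * 2 ^ n)                                   ≡⟨ r₂ cross n (2 ^ n) ⟩
  n * (4 * 2 ^ n) + 4 * cross                               ∎))
  where
  open ≤-Reasoning
  cross = ∑ (allSubsets n) products
  r₁ : ∀ n t → n * (n * t) ≡ t * (n * n)
  r₁ = solve-∀
  r₂ : ∀ cross n t → 4 * (cross + n * t) ≡ n * (4 * t) + 4 * cross
  r₂ = solve-∀
  low : ∀ p → ¬ High p → n * n + 4 * products p ≤ 4 * squares p
  low p ¬high = subst (λ m → m * m + 4 * products p ≤ 4 * squares p) (∣p∣+∣∁p∣≡n p)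
    (tail-pointwise (∣ p ∣) (∣ ∁ p ∣) (+-cancelʳ-≤ (∣ ∁ p ∣) _ _ (begin
      3 * ∣ ∁ p ∣ + ∣ ∁ p ∣  ≡⟨ r₃ (∣ ∁ p ∣) ⟩
      4 * ∣ ∁ p ∣            ≤⟨ <⇒≤ (≰⇒> ¬high) ⟩
      n                      ≡⟨ ∣p∣+∣∁p∣≡n p ⟨
      ∣ p ∣ + ∣ ∁ p ∣        ∎)))
    where
    r₃ : ∀ b → 3 * b + b ≡ 4 * b
    r₃ = solve-∀

-- On the tail no structure is used: all its sublists are listed, at a cost of ∣tail∣ bits, which
-- `3k|tail|≤mid` shows to be affordable.
covers-all : ∀ {D} {𝒟 : List (Family n)} → Covers D (filter high? (allSubsets n)) 𝒟 →
             Covers D (allSubsets n) (cartesianProductWith _++_ 𝒟 (sublists (tail n)))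
covers-all {n} {𝒟 = 𝒟} cov {F} sp F⊆
  with cov (sparse-⊆ (λ p∈ → proj₁ (∈-filter⁻ high? {xs = F} p∈)) sp) high⊆
     | sublists-cover {F = filter (¬? ∘ high?) F} {tail n} tail⊆
  where
  high⊆ : filter high? F ⊆ᴸ filter high? (allSubsets n)
  high⊆ {p} p∈ = ∈-filter⁺ high? (∈-allSubsets p) (proj₂ (∈-filter⁻ high? {xs = F} p∈))
  tail⊆ : filter (¬? ∘ high?) F ⊆ᴸ tail n
  tail⊆ {p} p∈ = ∈-filter⁺ (¬? ∘ high?) (∈-allSubsets p) (proj₂ (∈-filter⁻ (¬? ∘ high?) {xs = F} p∈))
... | G , G∈ , F⊆G , G⊆F | H , H∈ , F⊆H , H⊆F =
  G ++ H , ∈-cartesianProductWith⁺ _++_ G∈ H∈ , to , from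
  where
  to : F ⊆ᴸ G ++ H
  to {p} p∈ with high? p
  ... | yes h = ∈-++⁺ˡ (F⊆G (∈-filter⁺ high? p∈ h))
  ... | no ¬h = ∈-++⁺ʳ G (F⊆H (∈-filter⁺ (¬? ∘ high?) p∈ ¬h))
  from : G ++ H ⊆ᴸ F
  from p∈ with ∈-++⁻ G p∈
  ... | inj₁ q = proj₁ (∈-filter⁻ high? {xs = F} (G⊆F q))
  ... | inj₂ q = proj₁ (∈-filter⁻ (¬? ∘ high?) {xs = F} (H⊆F q))

-- Comparisons with powers of 2 and of 16

n<2^n : ∀ n → n < 2 ^ n
n<2^n zero    = s≤s z≤n
n<2^n (suc n) = begin-strict
  suc n            <⟨ s≤s (n<2^n n) ⟩
  suc (2 ^ n)      ≤⟨ +-monoˡ-≤ (2 ^ n) (m^n>0 2 n) ⟩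
  2 ^ n + 2 ^ n    ≡⟨ cong (2 ^ n +_) (+-identityʳ (2 ^ n)) ⟨
  2 ^ suc n        ∎
  where open ≤-Reasoning

-- At the start 2^(2a+4) = 2^a · 16 · 2^a, where the first factor absorbs a and the rest absorbs 2a
-- + 5 ≤ 16 (a+1). Each further step at most doubles the left side.
linear≤2^ : ∀ a u → 2 * a + 4 ≤ u → a * suc u ≤ 2 ^ u
linear≤2^ a u U≤u = subst (λ u → a * suc u ≤ 2 ^ u) (m∸n+n≡m U≤u) (go (u ∸ (2 * a + 4)))
  where
  open ≤-Reasoning
  go : ∀ v → a * suc (v + (2 * a + 4)) ≤ 2 ^ (v + (2 * a + 4))
  go zero = begin
    a * suc (2 * a + 4)          ≤⟨ *-mono-≤ (<⇒≤ (n<2^n a)) bound ⟩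
    2 ^ a * (16 * 2 ^ a)         ≡⟨ cong (2 ^ a *_) (^-distribˡ-+-* 2 4 a) ⟨
    2 ^ a * 2 ^ (4 + a)          ≡⟨ ^-distribˡ-+-* 2 a (4 + a) ⟨
    2 ^ (a + (4 + a))            ≡⟨ cong (2 ^_) (r₁ a) ⟩
    2 ^ (2 * a + 4)              ∎
    where
    r₁ : ∀ a → a + (4 + a) ≡ 2 * a + 4
    r₁ = solve-∀
    r₂ : ∀ a → suc (2 * a + 4) + (14 * a + 11) ≡ 16 * suc a
    r₂ = solve-∀
    bound : suc (2 * a + 4) ≤ 16 * 2 ^ a
    bound = ≤-trans (≤-trans (m≤m+n _ (14 * a + 11)) (≤-reflexive (r₂ a))) (*-monoʳ-≤ 16 (n<2^n a))
  go (suc v) = begin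
    a * suc (suc w)        ≤⟨ *-monoʳ-≤ a (s≤s (s≤s (m≤m+n w w))) ⟩
    a * suc (suc (w + w))  ≡⟨ r a w ⟩
    2 * (a * suc w)        ≤⟨ *-monoʳ-≤ 2 (go v) ⟩
    2 ^ suc w              ∎
    where
    w = v + (2 * a + 4)
    r : ∀ a w → a * suc (suc (w + w)) ≡ 2 * (a * suc w)
    r = solve-∀

-- Base 16 makes √n and n^(3/4) comparable to 4^u and 8^u, both of them powers of 2^u.
log₁₆ : ∀ n → 1 ≤ n → ∃[ u ] 16 ^ u ≤ n × n < 16 ^ suc u
log₁₆ (suc zero)    _ = 0 , ≤-refl , s≤s (s≤s z≤n)
log₁₆ (suc (suc n)) _ with log₁₆ (suc n) (s≤s z≤n)
... | u , 16^u≤ , <16^ with suc (suc n) <? 16 ^ suc u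
...   | yes lt = u , m≤n⇒m≤1+n 16^u≤ , lt
...   | no ¬lt = suc u , ≮⇒≥ ¬lt , ≤-<-trans <16^ (^-monoʳ-< 16 (s≤s (s≤s z≤n)) (n<1+n (suc u)))

square-cancel-≤ : ∀ a b → a * a ≤ b * b → a ≤ b
square-cancel-≤ a b a²≤b² = ≮⇒≥ λ b<a → <⇒≱ (*-mono-< b<a b<a) a²≤b²

^-distribʳ-* : ∀ o m n → (m * n) ^ o ≡ m ^ o * n ^ o
^-distribʳ-* zero    m n = refl
^-distribʳ-* (suc o) m n = trans (cong (m * n *_) (^-distribʳ-* o m n)) ([m*n]*[o*p]≡[m*o]*[n*p] m n (m ^ o) (n ^ o))

-- Choice of the parameters

-- With n ≈ 16^u the scale h = 8^u ≈ n^(3/4) lies well between √n and n / log n: q ≈ 2 h makes the factor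
-- (1 + 1/q)^(2^n) ≤ 2^(2^n / h) negligible since mid n ≈ 2^n / √n, while the degree threshold δ = q L with
-- L ≈ log n is still small compared with n, as supersaturation requires.
module Parameters (D k n u : ℕ) (1≤k : 1 ≤ k)
                  (16^u≤n : 16 ^ u ≤ n) (n<16^[1+u] : n < 16 ^ suc u) (8≤n : 8 ≤ n)
                  (u-large : 288 * (k * suc D) * suc u ≤ 2 ^ u) where

  open ≤-Reasoning

  t h q L δ M e j : ℕ
  t = 2 ^ u
  h = t * (t * t)
  -- Chosen so that q + 1 = 2h, the form required by `[1+q]^h≤2*q^h`.
  q = h + h ∸ 1
  -- 2^L = (16^(u+1))^(D+1) exceeds n^(D+1), which dominates (1 + δ)^D q.
  L = suc D * (4 * suc u)
  δ = q * L
  -- The error mid n / k is shared equally by three losses: the recursion, the excess of the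
  -- containers and the tail.
  M = 3 * k
  e = (suc M * mid n / M) {{>-nonZero (≤-trans 1≤k (m≤m+n k (2 * k)))}}
  -- This is 2^n / h, so that (1 + 1/q)^(2^n) = ((1 + 1/q)^h)^j ≤ 2^j.
  j = 2 ^ (n ∸ 3 * u)

  1≤t : 1 ≤ t
  1≤t = m^n>0 2 u

  1≤h : 1 ≤ h
  1≤h = *-mono-≤ 1≤t (*-mono-≤ 1≤t 1≤t)

  1+q≡h+h : suc q ≡ h + h
  1+q≡h+h = m+[n∸m]≡n (≤-trans 1≤h (m≤m+n h h))

  1≤q : 1 ≤ q
  1≤q = s≤s⁻¹ (≤-trans (+-mono-≤ 1≤h 1≤h) (≤-reflexive (sym 1+q≡h+h)))

  instance
    k≢0 : NonZero k
    k≢0 = >-nonZero 1≤k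
    M≢0 : NonZero M
    M≢0 = >-nonZero (≤-trans 1≤k (m≤m+n k (2 * k)))
    h≢0 : NonZero h
    h≢0 = >-nonZero 1≤h
    q≢0 : NonZero q
    q≢0 = >-nonZero 1≤q
    n≢0 : NonZero n
    n≢0 = >-nonZero (≤-trans (s≤s z≤n) 8≤n)

  2^[3*u]≡h : 2 ^ (3 * u) ≡ h
  2^[3*u]≡h = begin-equality
    2 ^ (u + (u + (u + 0)))    ≡⟨ cong (λ x → 2 ^ (u + (u + x))) (+-identityʳ u) ⟩
    2 ^ (u + (u + u))          ≡⟨ ^-distribˡ-+-* 2 u (u + u) ⟩
    t * 2 ^ (u + u)            ≡⟨ cong (t *_) (^-distribˡ-+-* 2 u u) ⟩
    h                          ∎

  16^u≡t*h : 16 ^ u ≡ t * h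
  16^u≡t*h = begin-equality
    16 ^ u                     ≡⟨ ^-*-assoc 2 4 u ⟩
    2 ^ (u + 3 * u)            ≡⟨ ^-distribˡ-+-* 2 u (3 * u) ⟩
    t * 2 ^ (3 * u)            ≡⟨ cong (t *_) 2^[3*u]≡h ⟩
    t * h                      ∎

  t*h≤n : t * h ≤ n
  t*h≤n = ≤-trans (≤-reflexive (sym 16^u≡t*h)) 16^u≤n

  -- 36 = 4 · 3 · 3 combines the quarter in `High`, the 3 in `M` and the 3 of `supersaturation`; 288
  -- = 36 · 2 · 4 adds q < 2h and the 4 in `L`.
  36kδ≤n : 36 * (k * δ) ≤ n
  36kδ≤n = begin
    36 * (k * (q * L))               ≤⟨ *-monoʳ-≤ 36 (*-monoʳ-≤ k (*-monoˡ-≤ L (≤-trans (n≤1+n q) (≤-reflexive 1+q≡h+h)))) ⟩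
    36 * (k * ((h + h) * L))         ≡⟨ r k h (suc D) (suc u) ⟩
    288 * (k * suc D) * suc u * h    ≤⟨ *-monoˡ-≤ h u-large ⟩
    t * h                            ≤⟨ t*h≤n ⟩
    n                                ∎
    where
    r : ∀ k h d u → 36 * (k * ((h + h) * (d * (4 * u)))) ≡ 288 * (k * d) * u * h
    r = solve-∀

  q≤δ : q ≤ δ
  q≤δ = ≤-trans (≤-reflexive (sym (*-identityʳ q))) (*-monoʳ-≤ q (*-mono-≤ {1} {suc D} {1} (s≤s z≤n) (s≤s z≤n)))

  1+δ≤n : suc δ ≤ n
  1+δ≤n = begin
    suc δ                            ≤⟨ +-monoˡ-≤ δ (≤-trans 1≤q q≤δ) ⟩
    δ + δ                            ≤⟨ +-mono-≤ δ≤kδ δ≤kδ ⟩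
    k * δ + k * δ                    ≤⟨ m≤m+n _ (34 * (k * δ)) ⟩
    k * δ + k * δ + 34 * (k * δ)     ≡⟨ r (k * δ) ⟩
    36 * (k * δ)                     ≤⟨ 36kδ≤n ⟩
    n                                ∎
    where
    δ≤kδ : δ ≤ k * δ
    δ≤kδ = m≤n*m δ k
    r : ∀ x → x + x + 34 * x ≡ 36 * x
    r = solve-∀

  [1+δ]^D*q≤2^L : suc δ ^ D * q ≤ 2 ^ L
  [1+δ]^D*q≤2^L = begin
    suc δ ^ D * q                    ≤⟨ *-mono-≤ (^-monoˡ-≤ D (≤-trans 1+δ≤n n≤)) (≤-trans q≤δ (≤-trans (n≤1+n δ) (≤-trans 1+δ≤n n≤))) ⟩
    (2 ^ (4 * suc u)) ^ D * 2 ^ (4 * suc u)   ≡⟨ *-comm ((2 ^ (4 * suc u)) ^ D) _ ⟩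
    (2 ^ (4 * suc u)) ^ suc D        ≡⟨ ^-*-assoc 2 (4 * suc u) (suc D) ⟩
    2 ^ (4 * suc u * suc D)          ≡⟨ cong (2 ^_) (*-comm (4 * suc u) (suc D)) ⟩
    2 ^ L                            ∎
    where
    n≤ : n ≤ 2 ^ (4 * suc u)
    n≤ = ≤-trans (<⇒≤ n<16^[1+u]) (≤-reflexive (^-*-assoc 2 4 (suc u)))

  -- Since δ = q L and (1 + 1/q)^q ≥ 2, the right side gains a factor of at least 2^L over q^δ.
  weights : suc δ ^ D * (q * q ^ δ) ≤ suc q ^ δ
  weights = begin
    suc δ ^ D * (q * q ^ δ)          ≡⟨ *-assoc (suc δ ^ D) q (q ^ δ) ⟨
    suc δ ^ D * q * q ^ δ            ≤⟨ *-monoˡ-≤ (q ^ δ) [1+δ]^D*q≤2^L ⟩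
    2 ^ L * q ^ (q * L)              ≡⟨ cong (2 ^ L *_) (^-*-assoc q q L) ⟨
    2 ^ L * (q ^ q) ^ L              ≡⟨ ^-distribʳ-* L 2 (q ^ q) ⟨
    (2 * q ^ q) ^ L                  ≤⟨ ^-monoˡ-≤ L (2*q^q≤[1+q]^q q) ⟩
    (suc q ^ q) ^ L                  ≡⟨ ^-*-assoc (suc q) q L ⟩
    suc q ^ δ                        ∎

  h*j≡2^n : h * j ≡ 2 ^ n
  h*j≡2^n = begin-equality
    h * j                            ≡⟨ cong (_* j) 2^[3*u]≡h ⟨
    2 ^ (3 * u) * j                  ≡⟨ ^-distribˡ-+-* 2 (3 * u) (n ∸ 3 * u) ⟨
    2 ^ (3 * u + (n ∸ 3 * u))        ≡⟨ cong (2 ^_) (m+[n∸m]≡n 3u≤n) ⟩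
    2 ^ n                            ∎
    where
    3u≤n : 3 * u ≤ n
    3u≤n = begin
      3 * u            ≤⟨ <⇒≤ (n<2^n (3 * u)) ⟩
      2 ^ (3 * u)      ≡⟨ 2^[3*u]≡h ⟩
      h                ≤⟨ m≤n*m h t {{>-nonZero 1≤t}} ⟩
      t * h            ≤⟨ t*h≤n ⟩
      n                ∎

  [1+q]^2^n≤ : suc q ^ (2 ^ n) ≤ 2 ^ j * q ^ (2 ^ n)
  [1+q]^2^n≤ = begin
    suc q ^ (2 ^ n)                  ≡⟨ cong (suc q ^_) h*j≡2^n ⟨
    suc q ^ (h * j)                  ≡⟨ ^-*-assoc (suc q) h j ⟨
    (suc q ^ h) ^ j                  ≤⟨ ^-monoˡ-≤ j ([1+q]^h≤2*q^h q h 1+q≡h+h) ⟩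
    (2 * q ^ h) ^ j                  ≡⟨ ^-distribʳ-* j 2 (q ^ h) ⟩
    2 ^ j * (q ^ h) ^ j              ≡⟨ cong (2 ^ j *_) (^-*-assoc q h j) ⟩
    2 ^ j * q ^ (h * j)              ≡⟨ cong (λ c → 2 ^ j * q ^ c) h*j≡2^n ⟩
    2 ^ j * q ^ (2 ^ n)              ∎

  -- 4 (n+1) ≤ 4 · 16^(u+1) = (8 t²)², so the square root in the central binomial estimate can be
  -- taken exactly.
  2^n≤8tt*mid : 2 ^ n ≤ 8 * (t * t) * mid n
  2^n≤8tt*mid = square-cancel-≤ (2 ^ n) _ (begin
    2 ^ n * 2 ^ n                            ≤⟨ 4^≤mid² n ⟩
    4 * suc n * (mid n * mid n)              ≤⟨ *-monoˡ-≤ (mid n * mid n) (*-monoʳ-≤ 4 n<16^[1+u]) ⟩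
    4 * (16 * 16 ^ u) * (mid n * mid n)      ≡⟨ cong (λ x → 4 * (16 * x) * (mid n * mid n)) 16^u≡t*h ⟩
    4 * (16 * (t * h)) * (mid n * mid n)     ≡⟨ r t (mid n) ⟩
    8 * (t * t) * mid n * (8 * (t * t) * mid n)  ∎)
    where
    r : ∀ t m → 4 * (16 * (t * (t * (t * t)))) * (m * m) ≡ 8 * (t * t) * m * (8 * (t * t) * m)
    r = solve-∀

  288k≤t : 288 * k ≤ t
  288k≤t = begin
    288 * k                      ≤⟨ *-monoʳ-≤ 288 (m≤m*n k (suc D)) ⟩
    288 * (k * suc D)            ≤⟨ m≤m*n (288 * (k * suc D)) (suc u) ⟩
    288 * (k * suc D) * suc u    ≤⟨ u-large ⟩
    t                            ∎

  -- j = 2^n / t³ is at most 8 mid n / t, and t ≥ 288 k; the 24 k that arises is padded to 288 k.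
  3kj≤mid : 3 * k * j ≤ mid n
  3kj≤mid = *-cancelˡ-≤ h (begin
    h * (3 * k * j)                        ≡⟨ r₁ h k j ⟩
    3 * k * (h * j)                        ≡⟨ cong (3 * k *_) h*j≡2^n ⟩
    3 * k * 2 ^ n                          ≤⟨ *-monoʳ-≤ (3 * k) 2^n≤8tt*mid ⟩
    3 * k * (8 * (t * t) * mid n)          ≤⟨ m≤m+n _ (264 * k * ((t * t) * mid n)) ⟩
    3 * k * (8 * (t * t) * mid n) + 264 * k * ((t * t) * mid n)  ≡⟨ r₂ k t (mid n) ⟩
    288 * k * ((t * t) * mid n)            ≤⟨ *-monoˡ-≤ ((t * t) * mid n) 288k≤t ⟩
    t * (t * t * mid n)                    ≡⟨ *-assoc t (t * t) (mid n) ⟨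
    h * mid n                              ∎)
    where
    r₁ : ∀ h k j → h * (3 * k * j) ≡ 3 * k * (h * j)
    r₁ = solve-∀
    r₂ : ∀ k t m → 3 * k * (8 * (t * t) * m) + 264 * k * ((t * t) * m) ≡ 288 * k * ((t * t) * m)
    r₂ = solve-∀

  3k|tail|≤mid : 3 * k * length (tail n) ≤ mid n
  3k|tail|≤mid = *-cancelˡ-≤ n (begin
    n * (3 * k * length (tail n))          ≡⟨ r₁ n k (length (tail n)) ⟩
    3 * k * (n * length (tail n))          ≤⟨ *-monoʳ-≤ (3 * k) (length-tail n) ⟩
    3 * k * (4 * 2 ^ n)                    ≤⟨ *-monoʳ-≤ (3 * k) (*-monoʳ-≤ 4 2^n≤8tt*mid) ⟩
    3 * k * (4 * (8 * (t * t) * mid n))    ≤⟨ m≤m+n _ (192 * k * ((t * t) * mid n)) ⟩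
    3 * k * (4 * (8 * (t * t) * mid n)) + 192 * k * ((t * t) * mid n)  ≡⟨ r₂ k t (mid n) ⟩
    288 * k * ((t * t) * mid n)            ≤⟨ *-monoˡ-≤ ((t * t) * mid n) 288k≤t ⟩
    t * (t * t * mid n)                    ≡⟨ *-assoc t (t * t) (mid n) ⟨
    h * mid n                              ≤⟨ *-monoˡ-≤ (mid n) (m≤n*m h t {{>-nonZero 1≤t}}) ⟩
    t * h * mid n                          ≤⟨ *-monoˡ-≤ (mid n) t*h≤n ⟩
    n * mid n                              ∎)
    where
    r₁ : ∀ n k j → n * (3 * k * j) ≡ 3 * k * (n * j)
    r₁ = solve-∀
    r₂ : ∀ k t m → 3 * k * (4 * (8 * (t * t) * m)) + 192 * k * ((t * t) * m) ≡ 288 * k * ((t * t) * m)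
    r₂ = solve-∀

  Me≤ : M * e ≤ suc M * mid n
  Me≤ = ≤-trans (≤-reflexive (*-comm M e)) (m/n*n≤m (suc M * mid n) M)

  ≤e : ∀ l → M * l ≤ suc M * mid n → l ≤ e
  ≤e l Ml≤ = subst (_≤ e) (m*n/n≡m l M) (/-monoˡ-≤ M (≤-trans (≤-reflexive (*-comm l M)) Ml≤))

  E : ℕ
  -- Exponents for the branching of the recursion, for the sublists of a container and for the
  -- traces on the tail.
  E = j + e + length (tail n)

  kE≤ : k * E ≤ suc k * mid n
  kE≤ = *-cancelˡ-≤ 3 (begin
    3 * (k * E)                                  ≡⟨ r₁ k j e (length (tail n)) ⟩
    3 * k * j + M * e + 3 * k * length (tail n)  ≤⟨ +-mono-≤ (+-mono-≤ 3kj≤mid Me≤) 3k|tail|≤mid ⟩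
    mid n + suc M * mid n + mid n                ≡⟨ r₂ k (mid n) ⟩
    3 * (suc k * mid n)                          ∎)
    where
    r₁ : ∀ k j e l → 3 * (k * (j + e + l)) ≡ 3 * k * j + 3 * k * e + 3 * k * l
    r₁ = solve-∀
    r₂ : ∀ k m → m + suc (3 * k) * m + m ≡ 3 * (suc k * m)
    r₂ = solve-∀

  high-bounds : ∀ {A} → A ∈ filter high? (allSubsets n) → 2 ≤ ∣ ∁ A ∣ × M * (3 * δ) ≤ ∣ ∁ A ∣
  high-bounds {A} A∈ = *-cancelˡ-≤ 4 (≤-trans 8≤n n≤) ,
    *-cancelˡ-≤ 4 (≤-trans (≤-reflexive (r k δ)) (≤-trans 36kδ≤n n≤))
    where
    n≤ : n ≤ 4 * ∣ ∁ A ∣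
    n≤ = proj₂ (∈-filter⁻ high? {xs = allSubsets n} A∈)
    r : ∀ k δ → 4 * (3 * k * (3 * δ)) ≡ 36 * (k * δ)
    r = solve-∀

  high-containers : ∃[ 𝒟 ] Covers D (filter high? (allSubsets n)) 𝒟 × length 𝒟 * q ^ (2 ^ n) ≤ suc q ^ (2 ^ n) * 2 ^ e
  high-containers = containers D δ M q (2 ^ e) weights (λ l Ml≤ → ^-monoʳ-≤ 2 (≤e l Ml≤)) (<-wellFounded (2 ^ n))
    (filter high? (allSubsets n)) (Uniqueₚ.filter⁺ high? (allSubsets-unique n))
    (≤-trans (length-filter high? (allSubsets n)) (≤-reflexive (length-allSubsets n))) high-bounds

  cancel-weights : ∀ N → N * q ^ (2 ^ n) ≤ suc q ^ (2 ^ n) * 2 ^ e → N ≤ 2 ^ (j + e)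
  cancel-weights N N≤ = *-cancelʳ-≤ _ _ (q ^ (2 ^ n)) {{m^n≢0 q (2 ^ n)}} (begin
    N * q ^ (2 ^ n)                    ≤⟨ N≤ ⟩
    suc q ^ (2 ^ n) * 2 ^ e            ≤⟨ *-monoˡ-≤ (2 ^ e) [1+q]^2^n≤ ⟩
    2 ^ j * q ^ (2 ^ n) * 2 ^ e        ≡⟨ r (2 ^ j) (q ^ (2 ^ n)) (2 ^ e) ⟩
    2 ^ j * 2 ^ e * q ^ (2 ^ n)        ≡⟨ cong (_* q ^ (2 ^ n)) (^-distribˡ-+-* 2 j e) ⟨
    2 ^ (j + e) * q ^ (2 ^ n)          ∎)
    where
    r : ∀ a b c → a * b * c ≡ a * c * b
    r = solve-∀

  covering : ∃[ 𝒟 ] Covers D (allSubsets n) 𝒟 × length 𝒟 ≤ 2 ^ E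
  covering = cartesianProductWith _++_ 𝒟 (sublists (tail n)) , covers-all (proj₁ (proj₂ high-containers)) , (begin
    length (cartesianProductWith _++_ 𝒟 (sublists (tail n)))  ≡⟨ length-cartesianProductWith _++_ 𝒟 (sublists (tail n)) ⟩
    length 𝒟 * length (sublists (tail n))                      ≡⟨ cong (length 𝒟 *_) (length-sublists (tail n)) ⟩
    length 𝒟 * 2 ^ length (tail n)                             ≤⟨ *-monoˡ-≤ (2 ^ length (tail n)) (cancel-weights (length 𝒟) (proj₂ (proj₂ high-containers))) ⟩
    2 ^ (j + e) * 2 ^ length (tail n)                          ≡⟨ ^-distribˡ-+-* 2 (j + e) (length (tail n)) ⟨
    2 ^ E                                                      ∎)
    where
    𝒟 : List (List (Subset n))
    𝒟 = proj₁ high-containers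

SparseCovering : ℕ → ℕ → ℕ → Set
SparseCovering D k n = ∃[ 𝒟 ] ∃[ E ] Covers D (allSubsets n) 𝒟 × length 𝒟 ≤ 2 ^ E × k * E ≤ suc k * mid n

sparse-covering : ∀ D k → 1 ≤ k → ∃[ N ] ∀ n → N ≤ n → SparseCovering D k n
sparse-covering D k 1≤k = 16 ^ U , at
  where
  a U : ℕ
  a = 288 * (k * suc D)
  -- If n ≥ 16^U then u ≥ U, the range in which `linear≤2^` gives `u-large`.
  U = 2 * a + 4
  at : ∀ n → 16 ^ U ≤ n → SparseCovering D k n
  at n N≤n =
    let u , 16^u≤n , n<16^ = log₁₆ n (≤-trans (m^n>0 16 U) N≤n)
        open Parameters D k n u 1≤k 16^u≤n n<16^ (8≤n n N≤n)
               (linear≤2^ a u (≮⇒≥ λ u<U → <⇒≱ n<16^ (≤-trans (^-monoʳ-≤ 16 u<U) N≤n)))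
    in proj₁ covering , E , proj₁ (proj₂ covering) , proj₂ (proj₂ covering) , kE≤
    where
    8≤n : ∀ n → 16 ^ U ≤ n → 8 ≤ n
    8≤n n N≤n = ≤-trans (m≤m+n 8 8) (≤-trans (^-monoʳ-≤ 16 {1} {U} (≤-trans (s≤s z≤n) (m≤n+m 4 (2 * a)))) N≤n)

-- Forbidden posets

-- `CountSat` needs a decision for every family, hence a search for copies. The search builds
-- vectors by `∷`, which recovers a given function only pointwise; `Q` must therefore respect
-- pointwise equality.
∃vector? : ∀ {X : Set} k (xs : List X) {Q : Vector X k → Set} → (∀ {f g} → (∀ i → f i ≡ g i) → Q f → Q g) →
           Decidable Q → Dec (∃[ f ] (∀ i → f i ∈ xs) × Q f)
∃vector? zero xs resp Q? = map′ (λ q → Vecᶠ.[] , (λ ()) , q) (λ (f , _ , q) → resp (λ ()) q) (Q? Vecᶠ.[])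
∃vector? {X} (suc k) xs {Q} resp Q? = map′ to from
  (any? (λ x → ∃vector? k xs {λ f → Q (x Vecᶠ.∷ f)} (λ eq → resp (∷-cong eq)) (λ f → Q? (x Vecᶠ.∷ f))) xs)
  where
  ∷-cong : ∀ {x} {f g : Vector _ k} → (∀ i → f i ≡ g i) → ∀ i → (x Vecᶠ.∷ f) i ≡ (x Vecᶠ.∷ g) i
  ∷-cong eq zero    = refl
  ∷-cong eq (suc i) = eq i
  eta : ∀ (f : Vector _ (suc k)) i → f i ≡ (f zero Vecᶠ.∷ (f ∘ suc)) i
  eta f zero    = refl
  eta f (suc i) = refl
  Extension : X → Set
  Extension x = ∃[ f ] (∀ i → f i ∈ xs) × Q (x Vecᶠ.∷ f)
  to : Any Extension xs → ∃[ f ] (∀ i → f i ∈ xs) × Q f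
  to p with find p
  ... | x , x∈ , f , f∈ , q = x Vecᶠ.∷ f , (λ { zero → x∈ ; (suc i) → f∈ i }) , q
  from : ∃[ f ] (∀ i → f i ∈ xs) × Q f → Any Extension xs
  from (f , f∈ , q) = lose (f∈ zero) (f ∘ suc , f∈ ∘ suc , resp (eta f) q)

graded-copy? : ∀ (l : Fin m → ℕ) (F : Family n) → Dec (InducedCopy (graded m l) F)
graded-copy? {m} {n} l F = ∃vector? m F resp-≗ dec
  where
  _≼_ : Fin m → Fin m → Set
  x ≼ y = x ≡ y ⊎ l x < l y
  Embedding : Vector (Subset n) m → Set
  Embedding i = (∀ {p q} → i p ≡ i q → p ≡ q) × (∀ p q → (p ≼ q) ⇔ (i p ⊆ i q))
  resp-≗ : ∀ {f g} → (∀ i → f i ≡ g i) → Embedding f → Embedding g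
  resp-≗ {f} {g} f≗g (inj , emb) =
    (λ {p} {q} e → inj (trans (f≗g p) (trans e (sym (f≗g q))))) ,
    λ p q → subst₂ (λ a b → (p ≼ q) ⇔ (a ⊆ b)) (f≗g p) (f≗g q) (emb p q)
  dec : Decidable Embedding
  dec i = map′ (λ h {p} {q} → h p q) (λ h p q → h) (Finₚ.all? λ p → Finₚ.all? λ q → (i p ≟ˢ i q) →-dec (p Fin.≟ q))
    ×-dec Finₚ.all? λ p → Finₚ.all? λ q →
      map′ (λ (f , g) → mk⇔ f g) (λ e → Equivalence.to e , Equivalence.from e)
        ((≼? p q →-dec (i p ⊆? i q)) ×-dec ((i p ⊆? i q) →-dec ≼? p q))
    where
    ≼? : ∀ p q → Dec (p ≼ q)
    ≼? p q = (p Fin.≟ q) ⊎-dec (l p <? l q)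

graded-free? : ∀ {P} (l : Fin m → ℕ) → P ≡ graded m l → (F : Family n) → Dec (InducedFree P F)
graded-free? l refl F = ¬? (graded-copy? l F)

-- Equal sizes within a level make distinct images incomparable, and sizes grow strictly from level
-- to level. Hence inclusions between images reflect the order without a separate check.
graded-copy : ∀ {F : Family n} (l : Fin m → ℕ) (i : Fin m → Subset n) → (∀ p → i p ∈ F) →
              (∀ p q → l p ≡ l q → ∣ i p ∣ ≡ ∣ i q ∣) →
              (∀ p q → l p ≡ l q → i p ≡ i q → p ≡ q) →
              (∀ p q → l p < l q → i p ⊆ i q × ∣ i p ∣ < ∣ i q ∣) →
              InducedCopy (graded m l) F
graded-copy l i i∈ same inj lt = i , i∈ , (λ {p} {q} → injective p q) , λ p q → mk⇔ (to p q) (from p q)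
  where
  injective : ∀ p q → i p ≡ i q → p ≡ q
  injective p q e with <-cmp (l p) (l q)
  ... | tri< a _ _ = contradiction (cong ∣_∣ e) (<⇒≢ (proj₂ (lt p q a)))
  ... | tri≈ _ b _ = inj p q b e
  ... | tri> _ _ c = contradiction (cong ∣_∣ (sym e)) (<⇒≢ (proj₂ (lt q p c)))
  to : ∀ p q → p ≡ q ⊎ l p < l q → i p ⊆ i q
  to p q (inj₁ refl) = λ x∈ → x∈
  to p q (inj₂ a)    = proj₁ (lt p q a)
  from : ∀ p q → i p ⊆ i q → p ≡ q ⊎ l p < l q
  from p q s with <-cmp (l p) (l q)
  ... | tri< a _ _ = inj₂ a
  ... | tri≈ _ b _ = inj₁ (inj p q b (⊆∧∣∣≡⇒≡ s (same p q b)))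
  ... | tri> _ _ c = contradiction (p⊆q⇒∣p∣≤∣q∣ s) (<⇒≱ (proj₂ (lt q p c)))

graded-copy⇒< : ∀ {F : Family n} (l : Fin m → ℕ) ((i , _) : InducedCopy (graded m l) F) →
                ∀ p q → l p < l q → ∣ i p ∣ < ∣ i q ∣
graded-copy⇒< l (i , _ , inj , emb) p q lt =
  ⊆∧≢⇒∣∣< (Equivalence.to (emb p q) (inj₂ lt)) λ e → <⇒≢ lt (cong l (inj e))

lookup-injective : ∀ {xs : List X} → Unique xs → ∀ i j → lookup xs i ≡ lookup xs j → i ≡ j
lookup-injective (x∉ ∷ u) zero    zero    e = refl
lookup-injective (x∉ ∷ u) zero    (suc j) e = contradiction e (All.lookup x∉ (∈-lookup j))
lookup-injective (x∉ ∷ u) (suc i) zero    e = contradiction (sym e) (All.lookup x∉ (∈-lookup i))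
lookup-injective (x∉ ∷ u) (suc i) (suc j) e = cong suc (lookup-injective u i j e)

select : ∀ {k} {xs : List X} → Unique xs → k ≤ length xs →
         ∃[ f ] (∀ (i : Fin k) → f i ∈ xs) × (∀ i j → f i ≡ f j → i ≡ j)
select {xs = xs} u k≤ = (λ i → lookup xs (inject≤ i k≤)) , (λ i → ∈-lookup (inject≤ i k≤)) ,
  λ i j e → Finₚ.inject≤-injective k≤ k≤ i j (lookup-injective u _ _ e)

vee-copy : ∀ {F : Family n} {A} r d S → A ∈ F → Unique S → r ≤ length S →
           (∀ {B} → B ∈ S → B ∈ F × Above A d B) → InducedCopy (vee r) F
vee-copy {n} {F} {A} r d S A∈ u r≤ S⊆ with select u r≤
... | f , f∈ , f-inj = graded-copy _ (A Vecᶠ.∷ f)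
  (λ { zero → A∈ ; (suc b) → proj₁ (S⊆ (f∈ b)) })
  (λ { zero zero _ → refl ; (suc b) (suc c) _ → trans (size b) (sym (size c)) ; zero (suc c) () ; (suc b) zero () })
  (λ { zero zero _ _ → refl ; (suc b) (suc c) _ e → cong suc (f-inj b c e) ; zero (suc c) () ; (suc b) zero () })
  (λ { zero (suc b) _ → proj₁ (proj₂ (S⊆ (f∈ b))) , subst (∣ A ∣ <_) (sym (size b)) (s≤s (m≤n+m ∣ A ∣ d))
     ; zero zero () ; (suc b) zero () ; (suc b) (suc c) (s≤s ()) })
  where
  size : ∀ b → ∣ f b ∣ ≡ suc d + ∣ A ∣
  size b = proj₂ (proj₂ (S⊆ (f∈ b)))

vee-free⇒sparse : ∀ D {F : Family n} → InducedFree (vee (suc D)) F → Sparse D F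
vee-free⇒sparse D free A∈ d S u S⊆ = ≮⇒≥ λ D<S → free (vee-copy (suc D) d S A∈ u D<S S⊆)

-- The level function of Kst is local to its definition; unification against graded recovers it.
levelOf : ∀ {P} {l : Fin m → ℕ} → P ≡ graded m l → Fin m → ℕ
levelOf {l = l} _ = l

kstLevel : ∀ s t → Fin (s + suc t) → ℕ
kstLevel s t = levelOf {P = Kst s t} refl

kstLevel-a : ∀ s t a → kstLevel s t (a ↑ˡ suc t) ≡ 0
kstLevel-a s t a with toℕ (a ↑ˡ suc t) <? s
... | yes _ = refl
... | no  ≮ = contradiction (subst (_< s) (sym (Finₚ.toℕ-↑ˡ a (suc t))) (Finₚ.toℕ<n a)) ≮

kstLevel-b : ∀ s t → kstLevel s t (s ↑ʳ zero) ≡ 1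
kstLevel-b s t with toℕ (s ↑ʳ zero {n = t}) <? s
... | yes lt = contradiction (≤-trans (m≤m+n s 0) (≤-reflexive (sym (Finₚ.toℕ-↑ʳ s (zero {n = t}))))) (<⇒≱ lt)
... | no  _ with toℕ (s ↑ʳ zero {n = t}) ≟ s
...   | yes _ = refl
...   | no  ≢ = contradiction (trans (Finₚ.toℕ-↑ʳ s (zero {n = t})) (+-identityʳ s)) ≢

kstLevel-c : ∀ s t c → kstLevel s t (s ↑ʳ suc c) ≡ 2
kstLevel-c s t c with toℕ (s ↑ʳ suc c) <? s
... | yes lt = contradiction (≤-trans (m≤m+n s (suc (toℕ c))) (≤-reflexive (sym (Finₚ.toℕ-↑ʳ s (suc c))))) (<⇒≱ lt)
... | no  _ with toℕ (s ↑ʳ suc c) ≟ s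
...   | yes e = contradiction (trans (sym (Finₚ.toℕ-↑ʳ s (suc c))) e) (m+1+n≢m s)
...   | no  _ = refl

module KstCopy {F : Family n} {B : Subset n} (B∈ : B ∈ F) {s t d d′ : ℕ}
               (f : Fin s → Subset n) (f-below : ∀ a → f a ∈ F × Above (f a) d B) (f-inj : ∀ i j → f i ≡ f j → i ≡ j)
               (g : Fin t → Subset n) (g-above : ∀ c → g c ∈ F × Above B d′ (g c)) (g-inj : ∀ i j → g i ≡ g j → i ≡ j) where

  -- It ties a position to its level and its image. After the single case analysis in `role`, all
  -- comparisons are matches on roles instead of on `splitAt`.
  data Role : Fin (s + suc t) → ℕ → Subset n → Set where
    a-role : ∀ a → Role (a ↑ˡ suc t) 0 (f a)
    b-role : Role (s ↑ʳ zero) 1 B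
    c-role : ∀ c → Role (s ↑ʳ suc c) 2 (g c)

  image : Fin (s + suc t) → Subset n
  image x = [ f , B Vecᶠ.∷ g ]′ (splitAt s x)

  role : ∀ x → Role x (kstLevel s t x) (image x)
  role x with splitAt s x in eq
  ... | inj₁ a rewrite sym (Finₚ.splitAt⁻¹-↑ˡ {i = x} eq) | kstLevel-a s t a = a-role a
  ... | inj₂ zero rewrite sym (Finₚ.splitAt⁻¹-↑ʳ {m = s} {i = x} eq) | kstLevel-b s t = b-role
  ... | inj₂ (suc c) rewrite sym (Finₚ.splitAt⁻¹-↑ʳ {m = s} {i = x} eq) | kstLevel-c s t c = c-role c

  role-∈ : ∀ {x k A} → Role x k A → A ∈ F
  role-∈ (a-role a) = proj₁ (f-below a)
  role-∈ b-role     = B∈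
  role-∈ (c-role c) = proj₁ (g-above c)

  role-same : ∀ {x y k k′ A A′} → Role x k A → Role y k′ A′ → k ≡ k′ → ∣ A ∣ ≡ ∣ A′ ∣
  role-same (a-role a) (a-role a′) refl = +-cancelˡ-≡ (suc d) _ _
    (trans (sym (proj₂ (proj₂ (f-below a)))) (proj₂ (proj₂ (f-below a′))))
  role-same b-role     b-role      refl = refl
  role-same (c-role c) (c-role c′) refl = trans (proj₂ (proj₂ (g-above c))) (sym (proj₂ (proj₂ (g-above c′))))

  role-inj : ∀ {x y k k′ A A′} → Role x k A → Role y k′ A′ → k ≡ k′ → A ≡ A′ → x ≡ y
  role-inj (a-role a) (a-role a′) refl e = cong (_↑ˡ suc t) (f-inj a a′ e)
  role-inj b-role     b-role      refl e = refl
  role-inj (c-role c) (c-role c′) refl e = cong (λ c → s ↑ʳ suc c) (g-inj c c′ e)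

  role-< : ∀ {x y k k′ A A′} → Role x k A → Role y k′ A′ → k < k′ → A ⊆ A′ × ∣ A ∣ < ∣ A′ ∣
  role-< (a-role a) (a-role _) ()
  role-< (a-role a) b-role     _ = below-B a
    where
    below-B : ∀ a → f a ⊆ B × ∣ f a ∣ < ∣ B ∣
    below-B a = let _ , f⊆B , e = f-below a in f⊆B , subst (∣ f a ∣ <_) (sym e) (s≤s (m≤n+m ∣ f a ∣ d))
  role-< (a-role a) (c-role c) _ =
    let a⊆B , a<B = role-< (a-role a) b-role (s≤s z≤n)
        B⊆c , B<c = role-< b-role (c-role c) (s≤s (s≤s z≤n))
    in (λ x∈ → B⊆c (a⊆B x∈)) , <-trans a<B B<c
  role-< b-role     (a-role _) ()
  role-< b-role     b-role     (s≤s ())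
  role-< b-role     (c-role c) _ =
    let _ , B⊆g , e = g-above c in B⊆g , subst (∣ B ∣ <_) (sym e) (s≤s (m≤n+m ∣ B ∣ d′))
  role-< (c-role _) (a-role _) ()
  role-< (c-role _) b-role     (s≤s ())
  role-< (c-role _) (c-role _) (s≤s (s≤s ()))

  kst-copy : InducedCopy (Kst s t) F
  kst-copy = graded-copy (kstLevel s t) image (λ p → role-∈ (role p)) (λ p q → role-same (role p) (role q))
    (λ p q → role-inj (role p) (role q)) (λ p q → role-< (role p) (role q))

∁-involutive : (p : Subset n) → ∁ (∁ p) ≡ p
∁-involutive []      = refl
∁-involutive (x ∷ p) = cong₂ _∷_ (Bool.not-involutive x) (∁-involutive p)

above-∁ : ∀ {A B : Subset n} {d} → Above (∁ B) d A → Above (∁ A) d B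
above-∁ {A = A} {B} {d} (∁B⊆A , e) = ∁p⊆∁q⇒p⊇q (subst (∁ B ⊆_) (sym (∁-involutive A)) ∁B⊆A) ,
  +-cancelʳ-≡ ∣ ∁ B ∣ _ _ (begin
    ∣ B ∣ + ∣ ∁ B ∣                 ≡⟨ trans (∣p∣+∣∁p∣≡n B) (sym (∣p∣+∣∁p∣≡n A)) ⟩
    ∣ A ∣ + ∣ ∁ A ∣                 ≡⟨ cong (_+ ∣ ∁ A ∣) e ⟩
    suc d + ∣ ∁ B ∣ + ∣ ∁ A ∣       ≡⟨ r (suc d) (∣ ∁ B ∣) (∣ ∁ A ∣) ⟩
    suc d + ∣ ∁ A ∣ + ∣ ∁ B ∣       ∎)
  where
  open ≡-Reasoning
  r : ∀ d a b → d + a + b ≡ d + b + a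
  r = solve-∀

-- A set of F with D + 1 sets of F above it on one level and D′ + 1 below it on another is the centre b of a
-- copy, so the sets that are crowded above are not crowded below; complementing turns below into above.
module KstSplit (D D′ : ℕ) {F : Family n} (u : Unique F) (free : InducedFree (Kst (suc D′) (suc D)) F) where

  F₁ F₂ : Family n
  F₁ = filter (¬? ∘ crowded? D F) F
  F₂ = filter (crowded? D F) F

  F₁-sparse : Sparse D F₁
  F₁-sparse {A} A∈ d S uS S⊆ = ≮⇒≥ λ D<S → proj₂ (∈-filter⁻ (¬? ∘ crowded? D F) {xs = F} A∈)
    (d , ≤-trans D<S (length-⊆ uS λ B∈ → ∈-filter⁺ (above? A d)
      (proj₁ (∈-filter⁻ (¬? ∘ crowded? D F) {xs = F} (proj₁ (S⊆ B∈)))) (proj₂ (S⊆ B∈))))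

  F₂-sparse : Sparse D′ (map ∁ F₂)
  F₂-sparse A∈ d S uS S⊆ = ≮⇒≥ λ D′<S → free (copy D′<S)
    where
    F₂⊆F : ∀ {A} → A ∈ map ∁ F₂ → ∁ A ∈ F
    F₂⊆F A∈ with ∈-map⁻ ∁ A∈
    ... | B , B∈ , refl = subst (_∈ F) (sym (∁-involutive B)) (proj₁ (∈-filter⁻ (crowded? D F) {xs = F} B∈))
    copy : D′ < length S → InducedCopy (Kst (suc D′) (suc D)) F
    copy D′<S with ∈-map⁻ ∁ A∈
    ... | B , B∈ , refl with ∈-filter⁻ (crowded? D F) {xs = F} B∈
    -- Crowdedness was measured in all of `F`, so the sets above B may lie outside `F₂`; they are
    -- still members of `F`, as the copy requires.
    ...   | B∈F , d′ , many with select uS D′<S | select (Uniqueₚ.filter⁺ (above? B d′) u) many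
    ...     | f , f∈ , f-inj | g , g∈ , g-inj = KstCopy.kst-copy B∈F
      (∁ ∘ f) (λ a → F₂⊆F (proj₁ (S⊆ (f∈ a))) , above-∁ (proj₂ (S⊆ (f∈ a))))
      (λ i j e → f-inj i j (trans (sym (∁-involutive (f i))) (trans (cong ∁ e) (∁-involutive (f j)))))
      g (λ c → ∈-filter⁻ (above? B d′) {xs = F} (g∈ c)) g-inj

union : Family n → Family n → Family n
union G H = G ++ map ∁ H

-- The second covering is applied to the complements of the members of `F₂`, and `union` complements
-- its families back.
kst-covers : ∀ D D′ {𝒟 𝒟′ : List (Family n)} → Covers D (allSubsets n) 𝒟 → Covers D′ (allSubsets n) 𝒟′ →
             ∀ {F} → Unique F → InducedFree (Kst (suc D′) (suc D)) F →
             ∃[ G ] G ∈ cartesianProductWith union 𝒟 𝒟′ × F ≐ G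
kst-covers {n} D D′ cov cov′ {F} u free =
  let G , G∈ , F₁⊆G , G⊆F₁ = cov F₁-sparse (λ {p} _ → ∈-allSubsets p)
      H , H∈ , F₂⊆H , H⊆F₂ = cov′ F₂-sparse (λ {p} _ → ∈-allSubsets p)
  in union G H , ∈-cartesianProductWith⁺ union G∈ H∈ , to F₁⊆G F₂⊆H , from G⊆F₁ H⊆F₂
  where
  open KstSplit D D′ u free
  to : ∀ {G H} → F₁ ⊆ᴸ G → map ∁ F₂ ⊆ᴸ H → F ⊆ᴸ union G H
  to {G} F₁⊆G F₂⊆H {A} A∈ with crowded? D F A
  ... | no ¬c = ∈-++⁺ˡ (F₁⊆G (∈-filter⁺ (¬? ∘ crowded? D F) A∈ ¬c))
  ... | yes c = ∈-++⁺ʳ G (subst (_∈ _) (∁-involutive A)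
    (∈-map⁺ ∁ (F₂⊆H (∈-map⁺ ∁ (∈-filter⁺ (crowded? D F) A∈ c)))))
  from : ∀ {G H} → G ⊆ᴸ F₁ → H ⊆ᴸ map ∁ F₂ → union G H ⊆ᴸ F
  from {G} {H} G⊆F₁ H⊆F₂ A∈ with ∈-++⁻ G A∈
  ... | inj₁ A∈G = proj₁ (∈-filter⁻ (¬? ∘ crowded? D F) {xs = F} (G⊆F₁ A∈G))
  ... | inj₂ A∈H with ∈-map⁻ ∁ A∈H
  ...   | B , B∈H , refl with ∈-map⁻ ∁ (H⊆F₂ B∈H)
  ...     | A , A∈F₂ , refl = subst (_∈ F) (sym (∁-involutive A)) (proj₁ (∈-filter⁻ (crowded? D F) {xs = F} A∈F₂))

-- Lower bounds and conclusion

-- By recursion, so that adding an element to the set shifts both arguments definitionally and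
-- Pascal's rule drives `∑-kronecker`.
kronecker : ℕ → ℕ → ℕ
kronecker zero    zero    = 1
kronecker zero    (suc j) = 0
kronecker (suc k) zero    = 0
kronecker (suc k) (suc j) = kronecker k j

kronecker-view : ∀ k j → kronecker k j ≡ 0 ⊎ kronecker k j ≡ 1 × j ≡ k
kronecker-view zero    zero    = inj₂ (refl , refl)
kronecker-view zero    (suc j) = inj₁ refl
kronecker-view (suc k) zero    = inj₁ refl
kronecker-view (suc k) (suc j) with kronecker-view k j
... | inj₁ e        = inj₁ e
... | inj₂ (e , e′) = inj₂ (e , cong suc e′)

∑-kronecker : ∀ n k → ∑[ p ← allSubsets n ] kronecker k (∣ p ∣) ≡ n C k
∑-kronecker zero    zero    = refl
∑-kronecker zero    (suc k) = refl
∑-kronecker (suc n) k = trans (∑-allSubsets n (λ p → kronecker k (∣ p ∣)))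
  (trans (∑-distrib-+ (allSubsets n) (λ p → kronecker k (∣ p ∣)) (λ p → kronecker k (suc ∣ p ∣))) (pascal k))
  where
  pascal : ∀ k → ∑[ p ← allSubsets n ] kronecker k (∣ p ∣) + ∑[ p ← allSubsets n ] kronecker k (suc ∣ p ∣) ≡ suc n C k
  pascal zero    = trans (cong₂ _+_ (∑-kronecker n 0) (trans (∑-const 0 (allSubsets n)) (*-zeroʳ (length (allSubsets n))))) refl
  pascal (suc k) = trans (cong₂ _+_ (∑-kronecker n (suc k)) (∑-kronecker n k))
    (trans (+-comm (n C suc k) (n C k)) (nCk+nC[k+1]≡[n+1]C[k+1] n k))

∑≤length-filter : ∀ {P : X → Set} (P? : Decidable P) xs {f : X → ℕ} →
                  (∀ x → f x ≤ 1) → (∀ x → ¬ P x → f x ≡ 0) → ∑ xs f ≤ length (filter P? xs)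
∑≤length-filter P? []       f≤1 f≡0 = z≤n
∑≤length-filter P? (x ∷ xs) f≤1 f≡0 with P? x
... | yes _ = +-mono-≤ (f≤1 x) (∑≤length-filter P? xs f≤1 f≡0)
... | no ¬p = +-mono-≤ (≤-reflexive (f≡0 x ¬p)) (∑≤length-filter P? xs f≤1 f≡0)

Layer Layers : ℕ → Subset n → Set
Layer  k p = ∣ p ∣ ≡ k
Layers k p = k ≤ ∣ p ∣ × ∣ p ∣ ≤ suc k

layer? : ∀ k → Decidable (Layer {n} k)
layer? k p = ∣ p ∣ ≟ k

layers? : ∀ k → Decidable (Layers {n} k)
layers? k p = (k ≤? ∣ p ∣) ×-dec (∣ p ∣ ≤? suc k)

length-layer : ∀ n k → n C k ≤ length (filter (layer? k) (allSubsets n))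
length-layer n k = ≤-trans (≤-reflexive (sym (∑-kronecker n k))) (∑≤length-filter (layer? k) (allSubsets n) ≤1 ≡0)
  where
  ≤1 : ∀ p → kronecker k (∣ p ∣) ≤ 1
  ≤1 p with kronecker-view k (∣ p ∣)
  ... | inj₁ e       = ≤-trans (≤-reflexive e) z≤n
  ... | inj₂ (e , _) = ≤-reflexive e
  ≡0 : ∀ p → ¬ Layer k p → kronecker k (∣ p ∣) ≡ 0
  ≡0 p ¬l with kronecker-view k (∣ p ∣)
  ... | inj₁ e       = e
  ... | inj₂ (_ , e) = contradiction e ¬l

length-layers : ∀ n k → n C k + n C suc k ≤ length (filter (layers? k) (allSubsets n))
length-layers n k = ≤-trans (≤-reflexive (sym ∑≡)) (∑≤length-filter (layers? k) (allSubsets n) ≤1 ≡0)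
  where
  both : Subset n → ℕ
  both p = kronecker k (∣ p ∣) + kronecker (suc k) (∣ p ∣)
  ∑≡ : ∑ (allSubsets n) both ≡ n C k + n C suc k
  ∑≡ = trans (∑-distrib-+ (allSubsets n) (λ p → kronecker k (∣ p ∣)) (λ p → kronecker (suc k) (∣ p ∣)))
    (cong₂ _+_ (∑-kronecker n k) (∑-kronecker n (suc k)))
  ≤1 : ∀ p → both p ≤ 1
  ≤1 p with kronecker-view k (∣ p ∣) | kronecker-view (suc k) (∣ p ∣)
  ... | inj₁ e       | inj₁ e′       = ≤-trans (≤-reflexive (cong₂ _+_ e e′)) z≤n
  ... | inj₁ e       | inj₂ (e′ , _) = ≤-reflexive (cong₂ _+_ e e′)
  ... | inj₂ (e , _) | inj₁ e′       = ≤-reflexive (cong₂ _+_ e e′)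
  ... | inj₂ (_ , e) | inj₂ (_ , e′) = contradiction (trans (sym e) e′) (<⇒≢ ≤-refl)
  ≡0 : ∀ p → ¬ Layers k p → both p ≡ 0
  ≡0 p ¬l with kronecker-view k (∣ p ∣) | kronecker-view (suc k) (∣ p ∣)
  ... | inj₁ e       | inj₁ e′       = cong₂ _+_ e e′
  ... | _            | inj₂ (_ , e)  = contradiction (≤-trans (n≤1+n k) (≤-reflexive (sym e)) , ≤-reflexive e) ¬l
  ... | inj₂ (_ , e) | inj₁ _        = contradiction (≤-reflexive (sym e) , ≤-trans (≤-reflexive e) (n≤1+n k)) ¬l

vee-free-layer : ∀ {r k} {F : Family n} → (∀ {p} → p ∈ F → Layer k p) → InducedFree (vee (suc r)) F
vee-free-layer flat copy@(i , i∈ , _) =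
  <⇒≢ (graded-copy⇒< _ copy zero (suc zero) (s≤s z≤n)) (trans (flat (i∈ zero)) (sym (flat (i∈ (suc zero)))))

kst-free-layers : ∀ {s t k} {F : Family n} → (∀ {p} → p ∈ F → Layers k p) → InducedFree (Kst (suc s) (suc t)) F
kst-free-layers {s = s} {t} {k} thin copy@(i , i∈ , _) = <⇒≱ (≤-trans (s≤s (proj₁ (thin (i∈ a)))) a<b)
  (s≤s⁻¹ (≤-trans b<c (proj₂ (thin (i∈ c)))))
  where
  l = kstLevel (suc s) (suc t)
  a b c : Fin (suc s + suc (suc t))
  a = zero {n = s} ↑ˡ suc (suc t)
  b = suc s ↑ʳ zero
  c = suc s ↑ʳ suc zero
  a<b : ∣ i a ∣ < ∣ i b ∣
  a<b = graded-copy⇒< l copy a b (subst₂ _<_ (sym (kstLevel-a (suc s) (suc t) zero)) (sym (kstLevel-b (suc s) (suc t))) (s≤s z≤n))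
  b<c : ∣ i b ∣ < ∣ i c ∣
  b<c = graded-copy⇒< l copy b c (subst₂ _<_ (sym (kstLevel-b (suc s) (suc t))) (sym (kstLevel-c (suc s) (suc t) zero)) (s≤s (s≤s z≤n)))

-- A counted family is the only sublist of `allSubsets n` with its members, so putting each entry of
-- `𝒟` into `canonical` form reaches all of them.
num-free-≤ : ∀ {P c} → NumFree P n c → (𝒟 : List (Family n)) →
             (∀ {F} → Unique F → InducedFree P F → ∃[ G ] G ∈ 𝒟 × F ≐ G) → c ≤ length 𝒟
num-free-≤ {n} {P} {c} cs 𝒟 cover = subst (c ≤_) (length-map canonical 𝒟)
  (count-≤ cs (sublists-unique (allSubsets-unique n)) (map canonical 𝒟) covered)
  where
  canonical : Family n → Family n
  canonical G = filter (_∈ᴸ? G) (allSubsets n)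
  covered : ∀ {F} → F ∈ allFamilies n → InducedFree P F → F ∈ map canonical 𝒟
  covered {F} F∈ free =
    let F⊑ = ∈-sublists⁻ (allSubsets n) F∈
        G , G∈ , F⊆G , G⊆F = cover (⊑-unique F⊑ (allSubsets-unique n)) free
    in subst (_∈ map canonical 𝒟)
         (sym (⊑-ext (allSubsets-unique n) F⊑ (filter-⊆ (_∈ᴸ? G) (allSubsets n))
           (λ {p} p∈ → ∈-filter⁺ (_∈ᴸ? G) (∈-allSubsets p) (F⊆G p∈))
           (λ p∈ → G⊆F (proj₂ (∈-filter⁻ (_∈ᴸ? G) {xs = allSubsets n} p∈)))))
         (∈-map⁺ canonical G∈)

num-free-≥ : ∀ {P c} → NumFree P n c → {Q : Subset n → Set} (Q? : Decidable Q) →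
             (∀ {F} → (∀ {p} → p ∈ F → Q p) → InducedFree P F) → 2 ^ length (filter Q? (allSubsets n)) ≤ c
num-free-≥ {n} {P} {c} cs Q? free = subst (_≤ c) (length-sublists (filter Q? (allSubsets n)))
  (count-≥ cs (sublists-unique (Uniqueₚ.filter⁺ Q? (allSubsets-unique n))) λ F∈ →
    let F⊑ = ∈-sublists⁻ (filter Q? (allSubsets n)) F∈
    in ∈-sublists⁺ (Sub.⊆-trans F⊑ (filter-⊆ Q? (allSubsets n))) ,
       free λ p∈ → proj₂ (∈-filter⁻ Q? {xs = allSubsets n} (Sub.lookup F⊑ p∈)))

power-≤ : ∀ {c E B} k → c ≤ 2 ^ E → k * E ≤ B → c ^ k ≤ 2 ^ B
power-≤ {c} {E} {B} k c≤ kE≤ = begin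
  c ^ k          ≤⟨ ^-monoˡ-≤ k c≤ ⟩
  (2 ^ E) ^ k    ≡⟨ ^-*-assoc 2 E k ⟩
  2 ^ (E * k)    ≡⟨ cong (2 ^_) (*-comm E k) ⟩
  2 ^ (k * E)    ≤⟨ ^-monoʳ-≤ 2 kE≤ ⟩
  2 ^ B          ∎
  where open ≤-Reasoning

power-≥ : ∀ {c E B} k → 2 ^ E ≤ c → B ≤ k * E → 2 ^ B ≤ c ^ k
power-≥ {c} {E} {B} k ≤c ≤kE = begin
  2 ^ B          ≤⟨ ^-monoʳ-≤ 2 ≤kE ⟩
  2 ^ (k * E)    ≡⟨ cong (2 ^_) (*-comm k E) ⟩
  2 ^ (E * k)    ≡⟨ ^-*-assoc 2 E k ⟨
  (2 ^ E) ^ k    ≤⟨ ^-monoˡ-≤ k ≤c ⟩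
  c ^ k          ∎
  where open ≤-Reasoning

-- With h = n/2, C(n, h+1) = mid n · (n-h)/(h+1) ≥ mid n · h/(h+1). The shortfall mid n / (h+1) is
-- at most mid n / k, because k ≤ h + 1.
mid-upper-neighbour : ∀ n k → 1 ≤ k → k + k ≤ n → k * mid n ≤ k * (n C suc (n / 2)) + mid n
mid-upper-neighbour n k 1≤k 2k≤n = *-cancelˡ-≤ (suc h) (begin
  suc h * (k * mid n)                  ≡⟨ r₁ h k (mid n) ⟩
  k * (h * mid n + mid n)              ≤⟨ *-monoʳ-≤ k (+-monoˡ-≤ (mid n) h*mid≤) ⟩
  k * (c * suc h + mid n)              ≡⟨ r₂ k c (suc h) (mid n) ⟩
  suc h * (k * c) + k * mid n          ≤⟨ +-monoʳ-≤ (suc h * (k * c)) (*-monoˡ-≤ (mid n) k≤1+h) ⟩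
  suc h * (k * c) + suc h * mid n      ≡⟨ *-distribˡ-+ (suc h) (k * c) (mid n) ⟨
  suc h * (k * c + mid n)              ∎)
  where
  open ≤-Reasoning
  h = n / 2
  c = n C suc h
  b = n ∸ suc h
  k≤1+h : k ≤ suc h
  k≤1+h = ≮⇒≥ λ 1+h<k → <⇒≱ (s≤s (s≤s (+-monoʳ-≤ h (m≤n+m h 2))))
    (≤-trans (+-mono-≤ 1+h<k 1+h<k) (≤-trans 2k≤n (n≤1+n/2+n/2 n)))
  1≤h : 1 ≤ h
  1≤h = ≮⇒≥ λ h<1 → <⇒≱ (s≤s (s≤s (+-mono-≤ (s≤s⁻¹ h<1) (s≤s⁻¹ h<1))))
    (≤-trans (+-mono-≤ 1≤k 1≤k) (≤-trans 2k≤n (n≤1+n/2+n/2 n)))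
  1+h≤n : suc h ≤ n
  1+h≤n = ≤-trans (+-monoˡ-≤ h 1≤h) (n/2+n/2≤n n)
  n≡ : n ≡ h + suc b
  n≡ = trans (sym (m+[n∸m]≡n 1+h≤n)) (sym (+-suc h b))
  h≤1+b : h ≤ suc b
  h≤1+b = +-cancelˡ-≤ h h (suc b) (≤-trans (n/2+n/2≤n n) (≤-reflexive n≡))
  h*mid≤ : h * mid n ≤ c * suc h
  h*mid≤ = begin
    h * mid n             ≤⟨ *-monoˡ-≤ (mid n) h≤1+b ⟩
    suc b * mid n         ≡⟨ *-comm (suc b) (mid n) ⟩
    (n C h) * suc b       ≡⟨ cong (λ N → (N C h) * suc b) n≡ ⟩
    ((h + suc b) C h) * suc b   ≡⟨ C-step h b ⟨
    ((h + suc b) C suc h) * suc h  ≡⟨ cong (λ N → (N C suc h) * suc h) n≡ ⟨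
    c * suc h             ∎
  r₁ : ∀ h k m → suc h * (k * m) ≡ k * (h * m + m)
  r₁ = solve-∀
  r₂ : ∀ k c s m → k * (c * s + m) ≡ s * (k * c) + k * m
  r₂ = solve-∀

vee-asymptotics : ∀ D → AsymptoticExp 1 (vee (suc D))
vee-asymptotics D k 1≤k = N , at
  where
  N = proj₁ (sparse-covering D k 1≤k)
  at : ∀ n → N ≤ n → ∃[ c ] NumFree (vee (suc D)) n c ×
       2 ^ ((1 * k ∸ 1) * mid n) ≤ c ^ k × c ^ k ≤ 2 ^ ((1 * k + 1) * mid n)
  at n N≤n =
    let c , cs = countSat (graded-free? _ refl) (allFamilies n)
        𝒟 , E , cov , length-𝒟 , kE≤ = proj₂ (sparse-covering D k 1≤k) n N≤n
        c≤ = num-free-≤ cs 𝒟 λ _ free → cov (vee-free⇒sparse D free) λ {p} _ → ∈-allSubsets p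
        ≤c = num-free-≥ cs (layer? (n / 2)) vee-free-layer
    in c , cs ,
       power-≥ k (≤-trans (^-monoʳ-≤ 2 (length-layer n (n / 2))) ≤c)
         (*-monoˡ-≤ (mid n) (≤-trans (m∸n≤m (1 * k) 1) (≤-reflexive (*-identityˡ k)))) ,
       power-≤ k (≤-trans c≤ length-𝒟)
         (≤-trans kE≤ (≤-reflexive (cong (_* mid n) (trans (+-comm 1 k) (cong (_+ 1) (sym (*-identityˡ k)))))))

kst-asymptotics : ∀ D′ D → AsymptoticExp 2 (Kst (suc D′) (suc D))
-- Two coverings with error 1/(2k) each add up to the error 1/k; the summand `k + k` serves
-- `mid-upper-neighbour`.
kst-asymptotics D′ D k 1≤k = proj₁ U + proj₁ U′ + (k + k) , at
  where
  1≤2k : 1 ≤ 2 * k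
  1≤2k = ≤-trans 1≤k (m≤m+n k (k + 0))
  U  = sparse-covering D  (2 * k) 1≤2k
  U′ = sparse-covering D′ (2 * k) 1≤2k
  kE-bound : ∀ E E′ M → 2 * k * E ≤ suc (2 * k) * M → 2 * k * E′ ≤ suc (2 * k) * M →
             k * (E + E′) ≤ (2 * k + 1) * M
  kE-bound E E′ M h h′ = *-cancelˡ-≤ 2 (≤-trans (≤-reflexive (r₁ k E E′)) (≤-trans (+-mono-≤ h h′) (≤-reflexive (r₂ k M))))
    where
    r₁ : ∀ k E E′ → 2 * (k * (E + E′)) ≡ 2 * k * E + 2 * k * E′
    r₁ = solve-∀
    r₂ : ∀ k M → suc (2 * k) * M + suc (2 * k) * M ≡ 2 * ((2 * k + 1) * M)
    r₂ = solve-∀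
  lower-bound : ∀ M c → k * M ≤ k * c + M → (2 * k ∸ 1) * M ≤ k * (M + c)
  lower-bound M c h = +-cancelʳ-≤ M _ _ (begin
    (2 * k ∸ 1) * M + M       ≡⟨ +-comm ((2 * k ∸ 1) * M) M ⟩
    suc (2 * k ∸ 1) * M       ≡⟨ cong (_* M) (m+[n∸m]≡n 1≤2k) ⟩
    2 * k * M                 ≡⟨ r₁ k M ⟩
    k * M + k * M             ≤⟨ +-monoʳ-≤ (k * M) h ⟩
    k * M + (k * c + M)       ≡⟨ r₂ k M c ⟩
    k * (M + c) + M           ∎)
    where
    open ≤-Reasoning
    r₁ : ∀ k M → 2 * k * M ≡ k * M + k * M
    r₁ = solve-∀
    r₂ : ∀ k M c → k * M + (k * c + M) ≡ k * (M + c) + M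
    r₂ = solve-∀
  at : ∀ n → proj₁ U + proj₁ U′ + (k + k) ≤ n → ∃[ c ] NumFree (Kst (suc D′) (suc D)) n c ×
       2 ^ ((2 * k ∸ 1) * mid n) ≤ c ^ k × c ^ k ≤ 2 ^ ((2 * k + 1) * mid n)
  at n N≤n =
    let N+N′≤n = m+n≤o⇒m≤o (proj₁ U + proj₁ U′) N≤n
        c , cs = countSat (graded-free? (kstLevel (suc D′) (suc D)) refl) (allFamilies n)
        𝒟 , E , cov , length-𝒟 , kE≤ = proj₂ U n (m+n≤o⇒m≤o (proj₁ U) N+N′≤n)
        𝒟′ , E′ , cov′ , length-𝒟′ , kE′≤ = proj₂ U′ n (m+n≤o⇒n≤o (proj₁ U) N+N′≤n)
        c≤ = num-free-≤ cs (cartesianProductWith union 𝒟 𝒟′) (kst-covers D D′ cov cov′)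
        ≤c = num-free-≥ cs (layers? (n / 2)) kst-free-layers
    in c , cs ,
       power-≥ k (≤-trans (^-monoʳ-≤ 2 (length-layers n (n / 2))) ≤c)
         (lower-bound (mid n) (n C suc (n / 2)) (mid-upper-neighbour n k 1≤k (m+n≤o⇒n≤o (proj₁ U + proj₁ U′) N≤n))) ,
       power-≤ k (≤-trans c≤ (≤-trans (≤-reflexive (length-cartesianProductWith union 𝒟 𝒟′))
           (≤-trans (*-mono-≤ length-𝒟 length-𝒟′) (≤-reflexive (sym (^-distribˡ-+-* 2 E E′))))))
         (kE-bound E E′ (mid n) kE≤ kE′≤)

theorem1p10 : ((r : ℕ) → 1 ≤ r → AsymptoticExp 1 (vee r)) ×
    ((s t : ℕ) → 1 ≤ s → 1 ≤ t → AsymptoticExp 2 (Kst s t))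
theorem1p10 = (λ { (suc D) _ → vee-asymptotics D }) , λ { (suc D′) (suc D) _ _ → kst-asymptotics D′ D }
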